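{- Let $\lambda$ be a Ferrers shape and let $\mathbf a=(a_1,a_2,\dots)$ be a finite sequence of positive integers. Then $$\bigl|W^{(a_1,a_2,\dots)}_\lambda(\{231,221\})\bigr|=\bigl|W^{(a_1,a_2,\dots)}_\lambda(\{312,212\})\bigr|.$$ That is, the sets of patterns $\{231,221\}$ and $\{312,212\}$ are shape-Wilf-equivalent for words.
   Context: A Ferrers shape $\lambda=(\lambda_1,\lambda_2,\dots)$ with $\lambda_1\ge\lambda_2\ge\cdots$ is drawn in French convention: a left-justified arrangement of cells with $\lambda_i$ cells in row $i$, rows numbered from bottom (row 1) to top; columns are numbered from left to right. A $0$-$1$-filling of $\lambda$ assigns $0$ or $1$ to each cell. For a word $x=x_1x_2\cdots x_r$ over the positive integers with largest letter $M$, let $M(x)$ be the $M\times r$ $0$-$1$ matrix (rows numbered bottom to top) having a $1$ in row $x_j$ of column $j$ for each $j$, and $0$ elsewhere. A filling $F$ of $\lambda$ contains $x$ if there are rows $\rho_1<\rho_2<\dots<\rho_M$ and columns $c_1<c_2<\dots<c_r$ such that every cell (row $\rho_l$, column $c_j$) lies in $\lambda$ and the entries of $F$ in these cells form exactly the matrix $M(x)$; otherwise $F$ avoids $x$. For a set $\Omega$ of words, $W^{(a_1,a_2,\dots)}_\lambda(\Omega)$ denotes the set of $0$-$1$-fillings of $\lambda$ with exactly one $1$ in each column, exactly $a_i$ ones in row $i$ for each $i$, and which avoid every word in $\Omega$. Two sets of words $\Omega,\Sigma$ are shape-Wilf-equivalent for words if $|W^{(a_1,a_2,\dots)}_\lambda(\Omega)|=|W^{(a_1,a_2,\dots)}_\lambda(\Sigma)|$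 for all finite sequences of positive integers $a_1,a_2,\dots$ and all Ferrers shapes $\lambda$. -}

module Defs where

open import Data.Fin using (Fin; toℕ)
open import Data.Fin.Patterns using (0F; 1F)
import Data.Fin as Fin
import Data.Fin.Properties as Fin
open import Data.List using (List; []; _∷_; length; filter; foldr; allFin; upTo; cartesianProductWith)
import Data.List as List
open import Data.List.Membership.Propositional using (_∈_)
open import Data.List.Membership.Propositional.Properties using (∈-allFin; ∈-cartesianProductWith⁺)
open import Data.List.Properties using (filter-none)
open import Data.List.Relation.Unary.All using (All; []; _∷_; all?; universal)
open import Data.List.Relation.Unary.Any using (here)
open import Data.List.Relation.Unary.AllPairs using ([]; _∷_)
open import Data.List.Relation.Unary.Linked using (Linked)
open import Data.List.Relation.Unary.Unique.Propositional using (Unique)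
open import Data.List.Relation.Unary.Unique.Propositional.Properties using (allFin⁺; cartesianProductWith⁺)
open import Data.Maybe using (Maybe; just; nothing)
open import Data.Maybe.Properties using (≡-dec)
open import Data.Nat using (ℕ; zero; suc; _≤_; _<_; _≥_; _⊔_; s≤s; _≟_; _<?_)
open import Data.Nat.Properties using (allUpTo?; ≮⇒≥; m⊔n≤o⇒m≤o; m⊔n≤o⇒n≤o)
open import Data.Product using (_×_; _,_; ∃)
open import Data.Vec using (Vec; []; _∷_; lookup)
import Data.Vec.Relation.Unary.Linked as VecLinked
open import Level using (Level)
open import Relation.Binary.PropositionalEquality using (_≡_; refl; sym; trans; cong)
open import Relation.Nullary using (¬_; Dec; yes; no; does)
open import Relation.Nullary.Decidable using (True; toWitness; map′; _×-dec_; ¬?)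
open import Relation.Unary using (Pred; Decidable)
open import Data.Bool using (if_then_else_)

-- Rows and columns are numbered from 0; row 0 is the bottom row.

-- A shape is the list of its row lengths, bottom row first.
-- Trailing zeros are allowed; they add no cells.
Shape : Set
Shape = List ℕ

IsFerrers : Shape → Set
IsFerrers = Linked _≥_

height : Shape → ℕ
height = length

-- The number of columns of a Ferrers shape is the length of its bottom row.
width : Shape → ℕ
width []      = 0
width (p ∷ _) = p

Filling : Shape → Set
Filling = All (Vec (Fin 2))

_‼_ : ∀ {a} {A : Set a} {n} → Vec A n → ℕ → Maybe A
[]       ‼ _     = nothing
(x ∷ xs) ‼ zero  = just x
(x ∷ xs) ‼ suc j = xs ‼ j

-- `nothing` means that the position is not a cell of the shape.
entry : ∀ {Λ} → Filling Λ → ℕ → ℕ → Maybe (Fin 2)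
entry []      _       _ = nothing
entry (r ∷ F) zero    j = r ‼ j
entry (r ∷ F) (suc i) j = entry F i j

entry≟ : ∀ {Λ} (F : Filling Λ) i j b → Dec (entry F i j ≡ just b)
entry≟ F i j b = ≡-dec Fin._≟_ (entry F i j) (just b)

onesInRow : ∀ {Λ} → Filling Λ → ℕ → ℕ
onesInRow {Λ} F i = length (filter (λ j → entry≟ F i j 1F) (upTo (width Λ)))

onesInColumn : ∀ {Λ} → Filling Λ → ℕ → ℕ
onesInColumn {Λ} F j = length (filter (λ i → entry≟ F i j 1F) (upTo (height Λ)))

record Word : Set where
  constructor mkWord
  field
    letters  : List ℕ
    positive : All (0 <_) letters

  largest : ℕ
  largest = foldr _⊔_ 0 letters

  -- Row l carries the letter l + 1.
  matrix : Fin largest → Fin (length letters) → Fin 2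
  matrix l j = if does (List.lookup letters j ≟ suc (toℕ l)) then 1F else 0F

open Word public using (letters; largest; matrix)

word : (xs : List ℕ) {_ : True (all? (0 <?_) xs)} → Word
word xs {p} = mkWord xs (toWitness p)

Increasing : ∀ {m n} → Vec (Fin m) n → Set
Increasing = VecLinked.Linked Fin._<_

IsOccurrence : ∀ {Λ} → Filling Λ → (x : Word) →
  Vec (Fin (height Λ)) (largest x) → Vec (Fin (width Λ)) (length (letters x)) → Set
IsOccurrence F x ρ c = Increasing ρ × Increasing c ×
  (∀ l j → entry F (toℕ (lookup ρ l)) (toℕ (lookup c j)) ≡ just (matrix x l j))

Contains : ∀ {Λ} → Filling Λ → Word → Set
Contains F x = ∃ λ ρ → ∃ λ c → IsOccurrence F x ρ c

Avoids : ∀ {Λ} → Filling Λ → Word → Set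
Avoids F x = ¬ Contains F x

-- A finite sequence, extended by zeros.
term : List ℕ → ℕ → ℕ
term []       _       = 0
term (a ∷ as) zero    = a
term (a ∷ as) (suc i) = term as i

-- A finite set of words is given by a list; order and repetitions are immaterial.
W : (Λ : Shape) → List ℕ → List Word → Filling Λ → Set
W Λ as Ω F =
  (∀ (j : Fin (width Λ)) → onesInColumn F (toℕ j) ≡ 1) ×
  (∀ i → onesInRow F i ≡ term as i) ×
  All (Avoids F) Ω

any-Vec? : ∀ {m n} {p : Level} {P : Pred (Vec (Fin m) n) p} → Decidable P → Dec (∃ P)
any-Vec? {n = zero}  P? = map′ ([] ,_) (λ { ([] , p) → p }) (P? [])
any-Vec? {n = suc n} P? =
  map′ (λ { (x , xs , p) → x ∷ xs , p }) (λ { (x ∷ xs , p) → x , xs , p })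
       (Fin.any? λ x → any-Vec? λ xs → P? (x ∷ xs))

contains? : ∀ {Λ} (F : Filling Λ) → Decidable (Contains F)
contains? F x = any-Vec? λ ρ → any-Vec? λ c →
  VecLinked.linked? Fin._<?_ ρ ×-dec VecLinked.linked? Fin._<?_ c ×-dec
  Fin.all? λ l → Fin.all? λ j → entry≟ F _ _ (matrix x l j)

entry-outside : ∀ {Λ} (F : Filling Λ) {i} j → height Λ ≤ i → entry F i j ≡ nothing
entry-outside []      _ _       = refl
entry-outside (r ∷ F) j (s≤s h) = entry-outside F j h

onesInRow-outside : ∀ {Λ} (F : Filling Λ) {i} → height Λ ≤ i → onesInRow F i ≡ 0
onesInRow-outside {Λ} F {i} h =
  cong length (filter-none (λ j → entry≟ F i j 1F) (universal outside (upTo (width Λ))))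
  where
  outside : ∀ j → ¬ entry F i j ≡ just 1F
  outside j e with () ← trans (sym (entry-outside F j h)) e

term-outside : ∀ as {i} → length as ≤ i → term as i ≡ 0
term-outside []       _       = refl
term-outside (a ∷ as) (s≤s h) = term-outside as h

rowSums? : ∀ {Λ} as (F : Filling Λ) → Dec (∀ i → onesInRow F i ≡ term as i)
rowSums? {Λ} as F =
  map′ extend (λ h {i} _ → h i) (allUpTo? (λ i → onesInRow F i ≟ term as i) bound)
  where
  bound : ℕ
  bound = height Λ ⊔ length as

  extend : (∀ {i} → i < bound → onesInRow F i ≡ term as i) → ∀ i → onesInRow F i ≡ term as i
  extend h i with i <? bound
  ... | yes i<b = h i<b
  ... | no  i≮b = trans (onesInRow-outside F (m⊔n≤o⇒m≤o (height Λ) _ (≮⇒≥ i≮b)))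
                        (sym (term-outside as (m⊔n≤o⇒n≤o (height Λ) _ (≮⇒≥ i≮b))))

W? : ∀ Λ as Ω → Decidable (W Λ as Ω)
W? Λ as Ω F =
  Fin.all? (λ j → onesInColumn F (toℕ j) ≟ 1) ×-dec
  rowSums? as F ×-dec
  all? (λ x → ¬? (contains? F x)) Ω

allVecs : ∀ n → List (Vec (Fin 2) n)
allVecs zero    = [] ∷ []
allVecs (suc n) = cartesianProductWith _∷_ (allFin 2) (allVecs n)

allFillings : ∀ Λ → List (Filling Λ)
allFillings []       = [] ∷ []
allFillings (p ∷ Λ) = cartesianProductWith _∷_ (allVecs p) (allFillings Λ)

∈-allVecs : ∀ {n} (v : Vec (Fin 2) n) → v ∈ allVecs n
∈-allVecs []      = here refl
∈-allVecs (b ∷ v) = ∈-cartesianProductWith⁺ _∷_ (∈-allFin b) (∈-allVecs v)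

∈-allFillings : ∀ {Λ} (F : Filling Λ) → F ∈ allFillings Λ
∈-allFillings []      = here refl
∈-allFillings (r ∷ F) = ∈-cartesianProductWith⁺ _∷_ (∈-allVecs r) (∈-allFillings F)

allVecs-unique : ∀ n → Unique (allVecs n)
allVecs-unique zero    = [] ∷ []
allVecs-unique (suc n) =
  cartesianProductWith⁺ _∷_ (λ { refl → refl , refl }) (allFin⁺ 2) (allVecs-unique n)

allFillings-unique : ∀ Λ → Unique (allFillings Λ)
allFillings-unique []       = [] ∷ []
allFillings-unique (p ∷ Λ) =
  cartesianProductWith⁺ _∷_ (λ { refl → refl , refl }) (allVecs-unique p) (allFillings-unique Λ)

-- By `∈-allFillings` and `allFillings-unique` this counts every filling satisfying P exactly once.
card : ∀ {Λ} {p : Level} {P : Pred (Filling Λ) p} → Decidable P → ℕ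
card {Λ} P? = length (filter P? (allFillings Λ))

∣W∣ : Shape → List ℕ → List Word → ℕ
∣W∣ Λ as Ω = card (W? Λ as Ω)

ShapeWilfEquivalent : List Word → List Word → Set
ShapeWilfEquivalent Ω Σ =
  ∀ (Λ : Shape) (as : List ℕ) → IsFerrers Λ → All (0 <_) as → ∣W∣ Λ as Ω ≡ ∣W∣ Λ as Σ

{-# OPTIONS --safe #-}
module Submission where

-- Walk along the border of λ from the bottom right to the top left and restrict the filling to the rectangle
-- below and to the left of the current vertex.  Skipping empty columns, it becomes a word: entering a row
-- inserts copies of a new largest letter, leaving a column removes the last letter, and the filling is
-- recovered from the removed letters.  For {312,212} the possible insertions depend only on the ascents of
-- the word; for {231,221} they depend only on a plane forest with the word as its preorder reading, where an
-- insertion puts the last few trees under a new root and appends leaves.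
--
-- Following Bloom and Saracino, both kinds of walks are compared through the lengths of longest increasing
-- subsequences at the border vertices.  For either pair of patterns these lengths are constrained by the same
-- local rules up to complementing increments, which gives one nondeterministic machine on binary labels.  A
-- label expands into a multiset of words (ascent words or forests), and expansion commutes with both steps,
-- so both numbers of fillings are the number of runs of the label machine.

open import Defs
open import Data.Bool using (Bool; T; true; false; if_then_else_)
open import Data.Empty using (⊥; ⊥-elim)
open import Data.Fin using (Fin; toℕ; fromℕ<)
open import Data.Fin.Patterns using (0F; 1F; 2F)
import Data.Fin as Fin
import Data.Fin.Properties as Fin
open import Data.List using (List; []; _∷_; [_]; _++_; map; concatMap; filter; length; replicate; downFrom; upTo; drop)
import Data.List as List
open import Data.List.Membership.Propositional using (_∈_; find; lose)
open import Data.List.Membership.Propositional.Properties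
open import Data.List.Membership.Propositional.Properties.WithK using (unique∧set⇒bag)
open import Data.List.Properties using (filter-accept; filter-reject; filter-all; filter-none; length-map; length-++; map-++; map-∘; map-cong; ∷-injective; ∷-injectiveˡ; ∷-injectiveʳ; ++-assoc; ++-cancelˡ; ++-identityʳ)
open import Data.List.Relation.Binary.BagAndSetEquality using (∼bag⇒↭)
open import Data.List.Relation.Binary.Permutation.Propositional.Properties using (↭-length)
open import Data.List.Relation.Unary.All using (All; []; _∷_)
import Data.List.Relation.Unary.All as All
import Data.List.Relation.Unary.All.Properties as All
open import Data.List.Relation.Unary.AllPairs using (AllPairs; []; _∷_)
import Data.List.Relation.Unary.AllPairs.Properties as AllPairs
open import Data.List.Relation.Unary.Any using (here; there)
open import Data.List.Relation.Unary.Linked using ([]; [-]; _∷_)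
open import Data.List.Relation.Unary.Unique.Propositional using (Unique)
import Data.List.Relation.Unary.Unique.Propositional.Properties as Unique
open import Data.Maybe using (Maybe; just)
open import Data.Maybe.Properties using (just-injective)
open import Data.Nat
open import Data.Nat.ListAction using (sum)
open import Data.Nat.ListAction.Properties using (sum-++)
open import Data.Nat.Properties
open import Data.Nat.Solver using (module +-*-Solver)
open import Data.Product using (_×_; _,_; ∃; proj₁; proj₂; map₂)
open import Data.Sum using (_⊎_; inj₁; inj₂)
open import Data.Unit using (⊤; tt)
open import Data.Vec using (Vec; []; _∷_; lookup; tabulate)
open import Data.Vec.Relation.Unary.Linked using ([]; [-]; _∷_) renaming (Linked to VecLinked)
import Data.Vec.Relation.Unary.Linked.Properties as VecLinked
open import Function using (_∘_; id; case_of_)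
open import Function.Bundles using (mk⇔)
open import Level using (0ℓ)
open import Relation.Binary.Definitions using (tri<; tri≈; tri>)
open import Relation.Binary.PropositionalEquality hiding ([_])
open import Relation.Nullary
open import Relation.Nullary.Decidable using (dec-true; dec-false)
open import Relation.Unary using (Pred; Decidable; _⊆_)

-- The states of the two machines cannot be matched one by one. The ascent word
-- `true ∷ false ∷ true ∷ []` admits two insertions, and three once its last letter is removed; a
-- forest with two possible insertions is a single tree, and removing its last node never leaves
-- more than one tree. Only multisets of states agree, so the column step of a label branches
-- although both machines are deterministic there. Both expansions are built by recursion along that
-- step, which makes the column identity almost definitional. The content is the row identity: the
-- insertions not accounted for by `false ∷ s` together give the expansion of `true ∷ s`
-- (`dom-insert`, `joins`). Equality of multisets is expressed as equality of sums against every
-- function `g`; this ignores the order of the lists, and taking the runs of the remaining path for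
-- `g` yields the induction on the path.

private variable
  A B : Set

-- Sums over lists

∑ : List A → (A → ℕ) → ℕ
∑ xs f = sum (map f xs)

∑-++ : ∀ xs ys (f : A → ℕ) → ∑ (xs ++ ys) f ≡ ∑ xs f + ∑ ys f
∑-++ xs ys f = trans (cong sum (map-++ f xs ys)) (sum-++ (map f xs) (map f ys))

∑-map : ∀ (g : A → B) xs (f : B → ℕ) → ∑ (map g xs) f ≡ ∑ xs (f ∘ g)
∑-map g xs f = cong sum (sym (map-∘ xs))

∑-cong : ∀ {f g : A → ℕ} xs → (∀ x → f x ≡ g x) → ∑ xs f ≡ ∑ xs g
∑-cong xs f≗g = cong sum (map-cong f≗g xs)

∑-congᴬ : ∀ {f g : A → ℕ} {xs} → All (λ x → f x ≡ g x) xs → ∑ xs f ≡ ∑ xs g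
∑-congᴬ []       = refl
∑-congᴬ (e ∷ es) = cong₂ _+_ e (∑-congᴬ es)

∑-concatMap : ∀ (g : A → List B) xs (f : B → ℕ) → ∑ (concatMap g xs) f ≡ ∑ xs (λ x → ∑ (g x) f)
∑-concatMap g []       f = refl
∑-concatMap g (x ∷ xs) f = trans (∑-++ (g x) _ f) (cong (∑ (g x) f +_) (∑-concatMap g xs f))

∑-+ : ∀ xs (f g : A → ℕ) → ∑ xs (λ x → f x + g x) ≡ ∑ xs f + ∑ xs g
∑-+ []       f g = refl
∑-+ (x ∷ xs) f g = trans (cong (f x + g x +_) (∑-+ xs f g))
  (solve 4 (λ a b c d → (a :+ b) :+ (c :+ d) := (a :+ c) :+ (b :+ d)) refl (f x) (g x) _ _)
  where open +-*-Solver

∑-0 : ∀ (xs : List A) → ∑ xs (λ _ → 0) ≡ 0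
∑-0 []       = refl
∑-0 (x ∷ xs) = ∑-0 xs

∑-[_] : ∀ (x : A) f → ∑ [ x ] f ≡ f x
∑-[ x ] f = +-identityʳ (f x)

-- Border paths and machines

-- Steps along the border from the bottom right to the top left: `row a` enters a row with a ones,
-- `col` leaves the last column.
data Step : Set where
  row : ℕ → Step
  col : Step

-- Beware of the shift: `afterRow a` enters a row with a + 1 ones.  A row without ones changes nothing.
record Machine : Set₁ where
  field
    State    : Set
    weight   : State → ℕ
    afterRow : ℕ → State → List State
    afterCol : State → List State

  runs : List Step → State → ℕ
  runs []                s = weight s
  runs (row zero    ∷ p) s = runs p s
  runs (row (suc a) ∷ p) s = ∑ (afterRow a s) (runs p)
  runs (col         ∷ p) s = ∑ (afterCol s) (runs p)

open Machine using (State; weight; afterRow; afterCol; runs)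

-- The label machine and its expansions

-- At most one outcome: the latest `false` is turned into `true`, and an all-true label has none.
raise : ∀ {n} → Vec Bool n → List (Vec Bool n)
raise []          = []
raise (false ∷ s) = [ true ∷ s ]
raise (true  ∷ s) = map (true ∷_) (raise s)

falses : ∀ {n} a → Vec Bool n → Vec Bool (a + n)
falses zero    s = s
falses (suc a) s = false ∷ falses a s

Labels : Set
Labels = ∃ (Vec Bool)

-- A label lists, latest first, increments of the lengths of longest increasing subsequences at border
-- vertices for {312,212}, and the complements of these increments for {231,221}, except that its earliest
-- entry is always true.  For {312,212}, `raise` turns the lengths back into ones with increments 0 and 1
-- after a column has been left without losing length.
labelMachine : Machine
labelMachine .State = Labels
labelMachine .weight (_ , [])    = 1
labelMachine .weight (_ , _ ∷ _) = 0
labelMachine .afterRow a (_ , [])        = [ _ , falses a (true ∷ []) ]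
labelMachine .afterRow a (_ , s@(_ ∷ _)) = (_ , falses a (false ∷ s)) ∷ [ _ , falses a (true ∷ s) ]
labelMachine .afterCol (_ , [])        = []
labelMachine .afterCol (_ , false ∷ s) = [ _ , s ]
labelMachine .afterCol (_ , true  ∷ s) = (_ , s) ∷ map (_ ,_) (raise s)

-- An invariant of the labels reached from the empty one: the first letter contributes `true`,
-- columns remove the latest entries, and `raise` only turns `false` into `true`. Without it `joins`
-- fails: for the label `false ∷ []` the left side has one join, the right side two forests.
Rooted : ∀ {n} → Vec Bool n → Set
Rooted []               = ⊤
Rooted (b ∷ [])         = T b
Rooted (_ ∷ s@(_ ∷ _))  = Rooted s

rooted-falses : ∀ {n} a (s : Vec Bool (suc n)) → Rooted s → Rooted (falses a s)
rooted-falses zero          s       r = r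
rooted-falses (suc zero)    (b ∷ s) r = r
rooted-falses (suc (suc a)) s       r = rooted-falses (suc a) s r

rooted-tail : ∀ {n} b (s : Vec Bool n) → Rooted (b ∷ s) → Rooted s
rooted-tail b []      r = tt
rooted-tail b (_ ∷ s) r = r

rooted-cons : ∀ {n} b (s : Vec Bool (suc n)) → Rooted s → Rooted (b ∷ s)
rooted-cons b (_ ∷ s) r = r

rooted-raise : ∀ {n} (s : Vec Bool n) → Rooted s → All Rooted (raise s)
rooted-raise []              r = []
rooted-raise (false ∷ c ∷ s) r = r ∷ []
rooted-raise (true ∷ [])     r = []
rooted-raise (true ∷ s@(_ ∷ _)) r = All.map⁺ (All.map (λ {t} → rooted-cons true t) (rooted-raise s r))

module Expansion (M : Machine) (expand : ∀ {n} → Vec Bool n → List (State M))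
  (expand-weight : ∀ {n} (s : Vec Bool n) → ∑ (expand s) (weight M) ≡ weight labelMachine (_ , s))
  (expand-row : ∀ a {n} (s : Vec Bool n) → Rooted s → ∀ g →
    ∑ (expand s) (λ y → ∑ (afterRow M a y) g) ≡ ∑ (afterRow labelMachine a (_ , s)) (λ t → ∑ (expand (proj₂ t)) g))
  (expand-col : ∀ {n} (s : Vec Bool n) g →
    ∑ (expand s) (λ y → ∑ (afterCol M y) g) ≡ ∑ (afterCol labelMachine (_ , s)) (λ t → ∑ (expand (proj₂ t)) g))
  where

  rowRooted : ∀ a {n} (s : Vec Bool n) → Rooted s → All (Rooted ∘ proj₂) (afterRow labelMachine a (_ , s))
  rowRooted a []        r = rooted-falses a (true ∷ []) tt ∷ []
  rowRooted a s@(_ ∷ _) r = rooted-falses a (false ∷ s) r ∷ rooted-falses a (true ∷ s) r ∷ []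

  colRooted : ∀ {n} (s : Vec Bool n) → Rooted s → All (Rooted ∘ proj₂) (afterCol labelMachine (_ , s))
  colRooted []          r = []
  colRooted (false ∷ s) r = rooted-tail false s r ∷ []
  colRooted (true  ∷ s) r = rooted-tail true s r ∷ All.map⁺ (rooted-raise s (rooted-tail true s r))

  runs-expand : ∀ p {n} (s : Vec Bool n) → Rooted s → ∑ (expand s) (runs M p) ≡ runs labelMachine p (_ , s)
  runs-expand []                s r = expand-weight s
  runs-expand (row zero    ∷ p) s r = runs-expand p s r
  runs-expand (row (suc a) ∷ p) s r =
    trans (expand-row a s r (runs M p))
          (∑-congᴬ (All.map (λ {t} → runs-expand p (proj₂ t)) (rowRooted a s r)))
  runs-expand (col         ∷ p) s r =
    trans (expand-col s (runs M p))
          (∑-congᴬ (All.map (λ {t} → runs-expand p (proj₂ t)) (colRooted s r)))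

-- Ascent words

-- The head belongs to the last letter, so the leading entries `false` describe the final weakly
-- decreasing run. A new block creates an ascent somewhere along that run and cannot go past the
-- ascent at which the run starts.
insertAscent : List Bool → List (List Bool)
insertAscentLater : List Bool → List (List Bool)
insertAscent u = (true ∷ u) ∷ insertAscentLater u
insertAscentLater []          = []
insertAscentLater (true  ∷ u) = []
insertAscentLater (false ∷ u) = map (false ∷_) (insertAscent u)

prependFalses : ℕ → List Bool → List Bool
prependFalses a u = replicate a false ++ u

prependFalses-comm : ∀ a u → false ∷ prependFalses a u ≡ prependFalses a (false ∷ u)
prependFalses-comm zero    u = refl
prependFalses-comm (suc a) u = cong (false ∷_) (prependFalses-comm a u)

-- The outcome with `false ∷ u` is the block placed just before the letter that starts the final
-- run: the block takes over its ascent and that letter becomes a weak descent. The empty word has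
-- no such letter. The remaining `a` copies of the block are the prepended entries `false`.
ascentMachine : Machine
ascentMachine .State = List Bool
ascentMachine .weight []      = 1
ascentMachine .weight (_ ∷ _) = 0
ascentMachine .afterRow a []        = map (prependFalses a) (insertAscent [])
ascentMachine .afterRow a u@(_ ∷ _) = prependFalses a (false ∷ u) ∷ map (prependFalses a) (insertAscent u)
ascentMachine .afterCol []      = []
ascentMachine .afterCol (_ ∷ u) = [ u ]

-- The ascent words with as many ascents as the label, none of them occurring later than in the label.
dominating : ∀ {n} → Vec Bool n → List (List Bool)
dominating []                  = [ [] ]
dominating {suc n} (false ∷ s) = map (false ∷_) (dominating {n} s)
dominating {suc n} (true  ∷ s) = map (true ∷_) (dominating {n} s) ++ map (false ∷_) (concatMap (dominating {n}) (raise s))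

module Ascents where
  open ≡-Reasoning
  -- A new ascent comes either at the head or behind a leading `false`. The second kind matches
  -- `raise`: an insertion behind `false` turns a label `false ∷ s` into `false` followed by words
  -- for `true ∷ s`, which is its raised label. Hence the mutual induction.
  dom-insert : ∀ {n} (s : Vec Bool n) g →
    ∑ (dominating s) (λ u → ∑ (insertAscent u) g) ≡ ∑ (dominating (true ∷ s)) g
  dom-insertLater : ∀ {n} (s : Vec Bool n) g →
    ∑ (dominating s) (λ u → ∑ (insertAscentLater u) g) ≡ ∑ (raise s) (λ t → ∑ (dominating t) (g ∘ (false ∷_)))

  dom-insert s g = begin
    ∑ (dominating s) (λ u → ∑ (insertAscent u) g)
      ≡⟨ ∑-+ (dominating s) (g ∘ (true ∷_)) (λ u → ∑ (insertAscentLater u) g) ⟩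
    ∑ (dominating s) (g ∘ (true ∷_)) + ∑ (dominating s) (λ u → ∑ (insertAscentLater u) g)
      ≡⟨ cong₂ _+_ (sym (∑-map (true ∷_) (dominating s) g)) (begin
          _ ≡⟨ dom-insertLater s g ⟩
          ∑ (raise s) (λ t → ∑ (dominating t) (g ∘ (false ∷_))) ≡⟨ ∑-concatMap dominating (raise s) _ ⟨
          ∑ (concatMap dominating (raise s)) (g ∘ (false ∷_)) ≡⟨ ∑-map (false ∷_) (concatMap dominating (raise s)) g ⟨
          _ ∎) ⟩
    _ ≡⟨ ∑-++ (map (true ∷_) (dominating s)) _ g ⟨
    ∑ (dominating (true ∷ s)) g ∎

  laterFalse : ∀ us (g : List Bool → ℕ) →
    ∑ (map (false ∷_) us) (λ u → ∑ (insertAscentLater u) g) ≡ ∑ us (λ u → ∑ (insertAscent u) (g ∘ (false ∷_)))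
  laterFalse us g = trans (∑-map (false ∷_) us _) (∑-cong us λ u → ∑-map (false ∷_) (insertAscent u) g)

  dom-insertLater []          g = refl
  dom-insertLater (false ∷ s) g = begin
    _ ≡⟨ laterFalse (dominating s) g ⟩
    _ ≡⟨ dom-insert s (g ∘ (false ∷_)) ⟩
    ∑ (dominating (true ∷ s)) (g ∘ (false ∷_)) ≡⟨ +-identityʳ _ ⟨
    _ ∎
  dom-insertLater (true ∷ s)  g = begin
    _ ≡⟨ ∑-++ (map (true ∷_) (dominating s)) _ _ ⟩
    -- A leading `true` blocks every later position, so only the words that begin with `false` and
    -- continue with a word of a raised label contribute.
    ∑ (map (true ∷_) (dominating s)) _ + ∑ (map (false ∷_) (concatMap dominating (raise s))) _
      ≡⟨ cong₂ _+_ (trans (∑-map (true ∷_) (dominating s) _) (∑-0 (dominating s))) (laterFalse (concatMap dominating (raise s)) g) ⟩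
    ∑ (concatMap dominating (raise s)) (λ u → ∑ (insertAscent u) (g ∘ (false ∷_)))
      ≡⟨ ∑-concatMap dominating (raise s) _ ⟩
    ∑ (raise s) (λ t → ∑ (dominating t) (λ u → ∑ (insertAscent u) (g ∘ (false ∷_))))
      ≡⟨ ∑-cong (raise s) (λ t → dom-insert t _) ⟩
    ∑ (raise s) (λ t → ∑ (dominating (true ∷ t)) (g ∘ (false ∷_)))
      ≡⟨ ∑-map (true ∷_) (raise s) _ ⟨
    _ ∎

  dom-falses : ∀ a {n} (s : Vec Bool n) g → ∑ (dominating (falses a s)) g ≡ ∑ (dominating s) (g ∘ prependFalses a)
  dom-falses zero    s g = refl
  dom-falses (suc a) s g = trans (∑-map (false ∷_) (dominating (falses a s)) g) (dom-falses a s _)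

  dom-weight : ∀ {n} (s : Vec Bool n) → ∑ (dominating s) (weight ascentMachine) ≡ weight labelMachine (_ , s)
  dom-weight []          = refl
  dom-weight (false ∷ s) = trans (∑-map (false ∷_) (dominating s) _) (∑-0 (dominating s))
  dom-weight (true ∷ s)  = trans (∑-++ (map (true ∷_) (dominating s)) _ _)
    (cong₂ _+_ (trans (∑-map (true ∷_) (dominating s) _) (∑-0 (dominating s)))
               (trans (∑-map (false ∷_) ts _) (∑-0 ts)))
    where ts = concatMap dominating (raise s)

  dom-col : ∀ {n} (s : Vec Bool n) g →
    ∑ (dominating s) (λ y → ∑ (afterCol ascentMachine y) g) ≡ ∑ (afterCol labelMachine (_ , s)) (λ t → ∑ (dominating (proj₂ t)) g)
  dom-col []          g = refl
  dom-col (false ∷ s) g = trans (∑-map (false ∷_) (dominating s) _)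
    (trans (∑-cong (dominating s) (λ u → +-identityʳ (g u))) (sym (+-identityʳ _)))
  dom-col (true ∷ s)  g = trans (∑-++ (map (true ∷_) (dominating s)) _ _)
    (cong₂ _+_ (trans (∑-map (true ∷_) (dominating s) _) (∑-cong (dominating s) (λ u → +-identityʳ (g u))))
               (trans (∑-map (false ∷_) ts _) (trans (∑-cong ts (λ u → +-identityʳ (g u)))
                 (trans (∑-concatMap dominating (raise s) g) (sym (∑-map (_ ,_) (raise s) _))))))
    where ts = concatMap dominating (raise s)

  -- Entering a row distinguishes the empty word; the words of a nonempty label are all nonempty, so
  -- the functions need to agree only there.
  dom-cong : ∀ {n} b (s : Vec Bool n) {f g : List Bool → ℕ} → (∀ c u → f (c ∷ u) ≡ g (c ∷ u)) →
    ∑ (dominating (b ∷ s)) f ≡ ∑ (dominating (b ∷ s)) g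
  dom-cong {n} false s {f} {g} f≗g = begin
    _ ≡⟨ ∑-map (false ∷_) (dominating s) f ⟩
    _ ≡⟨ ∑-cong (dominating s) (f≗g false) ⟩
    _ ≡⟨ ∑-map (false ∷_) (dominating s) g ⟨
    _ ∎
  dom-cong {n} true s {f} {g} f≗g = begin
    _ ≡⟨ split f ⟩
    _ ≡⟨ cong₂ _+_ (∑-cong (dominating s) (f≗g true)) (∑-cong ts (f≗g false)) ⟩
    _ ≡⟨ split g ⟨
    _ ∎
    where
    ts = concatMap dominating (raise s)
    split : ∀ h → ∑ (dominating (true ∷ s)) h ≡ ∑ (dominating s) (h ∘ (true ∷_)) + ∑ ts (h ∘ (false ∷_))
    split h = trans (∑-++ (map (true ∷_) (dominating s)) _ h)
      (cong₂ _+_ (∑-map (true ∷_) (dominating s) h) (∑-map (false ∷_) ts h))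

  dom-row : ∀ a {n} (s : Vec Bool n) → Rooted s → ∀ g →
    ∑ (dominating s) (λ y → ∑ (afterRow ascentMachine a y) g) ≡ ∑ (afterRow labelMachine a (_ , s)) (λ t → ∑ (dominating (proj₂ t)) g)
  dom-row a []        r g = begin
    _ ≡⟨ ∑-[ [] ] (λ y → ∑ (afterRow ascentMachine a y) g) ⟩
    ∑ (map (prependFalses a) [ true ∷ [] ]) g ≡⟨ ∑-map (prependFalses a) [ true ∷ [] ] g ⟩
    ∑ (dominating {1} (true ∷ [])) (g ∘ prependFalses a) ≡⟨ dom-falses a (true ∷ []) g ⟨
    ∑ (dominating (falses a (true ∷ []))) g ≡⟨ +-identityʳ _ ⟨
    _ ∎
  dom-row a s@(b ∷ s′) r g = begin
    ∑ (dominating s) (λ y → ∑ (afterRow ascentMachine a y) g)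
      ≡⟨ dom-cong b s′ (λ c u → cong (g (prependFalses a (false ∷ c ∷ u)) +_) (∑-map (prependFalses a) (insertAscent (c ∷ u)) g)) ⟩
    ∑ (dominating s) (λ u → g (prependFalses a (false ∷ u)) + ∑ (insertAscent u) (g ∘ prependFalses a))
      ≡⟨ ∑-+ (dominating s) _ _ ⟩
    ∑ (dominating s) (g ∘ prependFalses a ∘ (false ∷_)) + ∑ (dominating s) (λ u → ∑ (insertAscent u) (g ∘ prependFalses a))
      ≡⟨ cong₂ _+_ (sym (∑-map (false ∷_) (dominating s) (g ∘ prependFalses a))) (dom-insert s (g ∘ prependFalses a)) ⟩
    ∑ (dominating (false ∷ s)) (g ∘ prependFalses a) + ∑ (dominating (true ∷ s)) (g ∘ prependFalses a)
      ≡⟨ cong₂ _+_ (dom-falses a (false ∷ s) g) (dom-falses a (true ∷ s) g) ⟨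
    ∑ (dominating (falses a (false ∷ s))) g + ∑ (dominating (falses a (true ∷ s))) g
      ≡⟨ cong (∑ (dominating (falses a (false ∷ s))) g +_) (+-identityʳ _) ⟨
    _ ∎

  runs-ascents : ∀ p → runs ascentMachine p [] ≡ runs labelMachine p (_ , [])
  runs-ascents p = trans (sym (∑-[ [] ] (runs ascentMachine p)))
    (Expansion.runs-expand ascentMachine dominating dom-weight dom-row dom-col p [] tt)

-- Plane forests

-- Trees are appended on the right, `a` being the root of the last tree and `C` the forest below it.
-- Cuts between trees and the last node in preorder are then reached by recursion along the right
-- side.
data Forest (A : Set) : Set where
  ε      : Forest A
  _▷[_]_ : Forest A → A → Forest A → Forest A

splits proper : Forest A → List (Forest A × Forest A)
splits F = (F , ε) ∷ proper F
proper ε            = []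
proper (F ▷[ a ] C) = map (map₂ (_▷[ a ] C)) (splits F)

addLeaves : ℕ → A → Forest A → Forest A
addLeaves zero    a F = F
addLeaves (suc n) a F = addLeaves n a F ▷[ a ] ε

-- The first of the `n + 1` new letters becomes the root above the trees cut off; the others end the
-- word and become leaves at top level.
insertRow : ℕ → A → Forest A × Forest A → Forest A
insertRow n a (F , C) = addLeaves n a (F ▷[ a ] C)

dropLast : Forest A → Forest A
dropLast ε                         = ε
dropLast (F ▷[ a ] ε)              = F
dropLast (F ▷[ a ] C@(_ ▷[ _ ] _)) = F ▷[ a ] dropLast C

forestMachine : Machine
forestMachine .State = Forest ⊤
forestMachine .weight ε             = 1
forestMachine .weight (_ ▷[ _ ] _)  = 0
forestMachine .afterRow n F = map (insertRow n tt) (splits F)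
forestMachine .afterCol ε               = []
forestMachine .afterCol F@(_ ▷[ _ ] _)  = [ dropLast F ]

-- The number is the depth of the new last node on the right spine. Among rooted labels the clause
-- for a positive number and `ε` is reached only by all-true ones: their forest is a chain, and
-- their number of leading `true` exceeds the depth of the last node by one.
attach : ℕ → Forest ⊤ → Forest ⊤
attach zero    F            = F ▷[ tt ] ε
attach (suc c) ε            = ε ▷[ tt ] ε
attach (suc c) (F ▷[ a ] C) = F ▷[ a ] attach c C

depth : ∀ {n} → Vec Bool n → ℕ
depth []          = 0
depth (false ∷ s) = 0
depth (true ∷ s)  = suc (depth s)

-- Removing the last node undoes `attach`, so the recursion follows `afterCol` of the label machine.
forests : ∀ {n} → Vec Bool n → List (Forest ⊤)
forests []                  = [ ε ]
forests {suc n} (false ∷ s) = map (attach 0) (forests {n} s)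
forests {suc n} (true  ∷ s) = map (attach (suc (depth s))) (forests {n} s ++ concatMap (forests {n}) (raise s))

module Forests where
  open ≡-Reasoning

  joinTrees : Forest ⊤ × Forest ⊤ → Forest ⊤
  joinTrees (F , C) = F ▷[ tt ] C

  attach-nonempty : ∀ k F → ∃ λ G → ∃ λ C → attach k F ≡ G ▷[ tt ] C
  attach-nonempty zero    F            = _ , _ , refl
  attach-nonempty (suc k) ε            = _ , _ , refl
  attach-nonempty (suc k) (F ▷[ _ ] C) = _ , _ , refl

  dropLast-attach : ∀ k F → dropLast (attach k F) ≡ F
  dropLast-attach zero    F            = refl
  dropLast-attach (suc k) ε            = refl
  dropLast-attach (suc k) (F ▷[ a ] C) with attach k C | attach-nonempty k C | dropLast-attach k C
  ... | .(_ ▷[ _ ] _) | _ , _ , refl | e = cong (F ▷[ a ]_) e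

  ∑-attach : ∀ k Fs (f g : Forest ⊤ → ℕ) → (∀ F C → f (F ▷[ tt ] C) ≡ g (F ▷[ tt ] C)) →
    ∑ (map (attach k) Fs) f ≡ ∑ (map (attach k) Fs) g
  ∑-attach k Fs f g f≗g = begin
    _ ≡⟨ ∑-map (attach k) Fs f ⟩
    _ ≡⟨ ∑-cong Fs (λ F → let (G , C , e) = attach-nonempty k F in subst (λ H → f H ≡ g H) (sym e) (f≗g G C)) ⟩
    _ ≡⟨ ∑-map (attach k) Fs g ⟨
    _ ∎

  predecessors : ∀ {n} → Vec Bool n → List (Forest ⊤)
  predecessors s = forests s ++ concatMap forests (raise s)

  ∑-nonempty : ∀ {n} b (s : Vec Bool n) (f g : Forest ⊤ → ℕ) → (∀ F C → f (F ▷[ tt ] C) ≡ g (F ▷[ tt ] C)) →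
    ∑ (forests (b ∷ s)) f ≡ ∑ (forests (b ∷ s)) g
  ∑-nonempty false s = ∑-attach 0 (forests s)
  ∑-nonempty true  s = ∑-attach (suc (depth s)) (predecessors s)

  ∑-predecessors : ∀ {n} (s : Vec Bool n) f →
    ∑ (predecessors s) f ≡ ∑ (forests s) f + ∑ (raise s) (λ t → ∑ (forests t) f)
  ∑-predecessors s f = trans (∑-++ (forests s) _ f) (cong (∑ (forests s) f +_) (∑-concatMap forests (raise s) f))

  -- A node attached inside the last tree leaves the cuts between trees unchanged, and every proper
  -- cut puts the last tree one level lower, below the new root. So the depth `suc k` becomes
  -- `2 + k`.
  proper-attach : ∀ k F C (g : Forest ⊤ → ℕ) →
    ∑ (proper (attach (suc k) (F ▷[ tt ] C))) (g ∘ joinTrees) ≡ ∑ (proper (F ▷[ tt ] C)) (g ∘ attach (2 + k) ∘ joinTrees)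
  proper-attach k F C g = trans (∑-map (map₂ (_▷[ tt ] attach k C)) (splits F) _) (sym (∑-map (map₂ (_▷[ tt ] C)) (splits F) _))

  -- Joining commutes with attaching the last node, one level deeper. Taking off the last node
  -- therefore reduces the joins for `b ∷ s` to joins for shorter labels, and these reassemble into
  -- the predecessors of `true ∷ b ∷ s`.
  joins : ∀ {n} b (s : Vec Bool n) → Rooted (b ∷ s) → ∀ g →
    ∑ (forests (b ∷ s)) (λ F → ∑ (proper F) (g ∘ joinTrees)) ≡ ∑ (forests (true ∷ b ∷ s)) g
  joins true [] _ g = +-identityʳ _
  joins false s@(c ∷ s′) r g = begin
    ∑ (forests (false ∷ s)) (λ F → ∑ (proper F) (g ∘ joinTrees))
      ≡⟨ ∑-map (attach 0) (forests s) (λ F → ∑ (proper F) (g ∘ joinTrees)) ⟩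
    ∑ (forests s) (λ F → ∑ (proper (attach 0 F)) (g ∘ joinTrees))
      -- The last tree is a single leaf. Cutting off only this tree gives `attach 1 (attach 0 F)`;
      -- every other cut is a proper cut of `F`, joined, with the leaf attached at depth one. These
      -- two kinds will be the two summands of `predecessors (false ∷ s)`.
      ≡⟨ ∑-cong (forests s) (λ F → ∑-map (map₂ (_▷[ tt ] ε)) (splits F) (g ∘ joinTrees)) ⟩
    ∑ (forests s) (λ F → g (attach 1 (attach 0 F)) + ∑ (proper F) (g ∘ attach 1 ∘ joinTrees))
      ≡⟨ ∑-+ (forests s) (g ∘ attach 1 ∘ attach 0) (λ F → ∑ (proper F) (g ∘ attach 1 ∘ joinTrees)) ⟩
    ∑ (forests s) (g ∘ attach 1 ∘ attach 0) + ∑ (forests s) (λ F → ∑ (proper F) (g ∘ attach 1 ∘ joinTrees))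
      ≡⟨ cong₂ _+_ (sym (∑-map (attach 0) (forests s) (g ∘ attach 1))) (trans (joins c s′ r (g ∘ attach 1)) (sym (+-identityʳ _))) ⟩
    ∑ (forests (false ∷ s)) (g ∘ attach 1) + (∑ (forests (true ∷ s)) (g ∘ attach 1) + 0)
      ≡⟨ ∑-predecessors (false ∷ s) (g ∘ attach 1) ⟨
    ∑ (predecessors (false ∷ s)) (g ∘ attach 1)
      ≡⟨ ∑-map (attach 1) (predecessors (false ∷ s)) g ⟨
    ∑ (forests (true ∷ false ∷ s)) g ∎
  joins true s@(c ∷ s′) r g = begin
    ∑ (forests (true ∷ s)) (λ F → ∑ (proper F) (g ∘ joinTrees))
      ≡⟨ ∑-map (attach k) (predecessors s) (λ F → ∑ (proper F) (g ∘ joinTrees)) ⟩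
    ∑ (predecessors s) (λ F → ∑ (proper (attach k F)) (g ∘ joinTrees))
      ≡⟨ ∑-predecessors s (λ F → ∑ (proper (attach k F)) (g ∘ joinTrees)) ⟩
    ∑ (forests s) (λ F → ∑ (proper (attach k F)) (g ∘ joinTrees))
      + ∑ (raise s) (λ t → ∑ (forests t) (λ F → ∑ (proper (attach k F)) (g ∘ joinTrees)))
      -- The induction hypothesis applies to `s` and to each raised label, which stays nonempty and
      -- rooted. Since `raise` skips a leading `true`, the labels `true ∷ t` obtained are those of
      -- `raise (true ∷ s)`.
      ≡⟨ cong₂ _+_ (lift c s′ r) (∑-congᴬ (All.map (λ { {c ∷ t} → lift c t }) (rooted-raise s r))) ⟩
    ∑ (forests (true ∷ s)) (g ∘ attach (suc k)) + ∑ (raise s) (λ t → ∑ (forests (true ∷ t)) (g ∘ attach (suc k)))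
      ≡⟨ cong (∑ (forests (true ∷ s)) (g ∘ attach (suc k)) +_) (∑-map (true ∷_) (raise s) (λ t → ∑ (forests t) (g ∘ attach (suc k)))) ⟨
    ∑ (forests (true ∷ s)) (g ∘ attach (suc k)) + ∑ (raise (true ∷ s)) (λ t → ∑ (forests t) (g ∘ attach (suc k)))
      ≡⟨ ∑-predecessors (true ∷ s) (g ∘ attach (suc k)) ⟨
    ∑ (predecessors (true ∷ s)) (g ∘ attach (suc k))
      ≡⟨ ∑-map (attach (suc k)) (predecessors (true ∷ s)) g ⟨
    ∑ (forests (true ∷ true ∷ s)) g ∎
    where
    k = suc (depth s)
    lift : ∀ c (t : Vec Bool _) → Rooted (c ∷ t) →
      ∑ (forests (c ∷ t)) (λ F → ∑ (proper (attach k F)) (g ∘ joinTrees)) ≡ ∑ (forests (true ∷ c ∷ t)) (g ∘ attach (suc k))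
    lift c t r = trans (∑-nonempty c t _ _ (λ F C → proper-attach (depth s) F C g)) (joins c t r (g ∘ attach (suc k)))

  ∑-addLeaves : ∀ a {n} (s : Vec Bool n) g → ∑ (forests (falses a s)) g ≡ ∑ (forests s) (g ∘ addLeaves a tt)
  ∑-addLeaves zero    s g = refl
  ∑-addLeaves (suc a) s g = trans (∑-map (attach 0) (forests (falses a s)) g) (∑-addLeaves a s (g ∘ attach 0))

  forests-weight : ∀ {n} (s : Vec Bool n) → ∑ (forests s) (weight forestMachine) ≡ weight labelMachine (_ , s)
  forests-weight []      = refl
  forests-weight (b ∷ s) = trans (∑-nonempty b s _ (λ _ → 0) (λ _ _ → refl)) (∑-0 (forests (b ∷ s)))

  dropLast-step : ∀ k F g → ∑ (afterCol forestMachine (attach k F)) g ≡ g F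
  dropLast-step k F g with attach k F | attach-nonempty k F | dropLast-attach k F
  ... | .(_ ▷[ _ ] _) | _ , _ , refl | refl = +-identityʳ _

  forests-col : ∀ {n} (s : Vec Bool n) g →
    ∑ (forests s) (λ y → ∑ (afterCol forestMachine y) g) ≡ ∑ (afterCol labelMachine (_ , s)) (λ t → ∑ (forests (proj₂ t)) g)
  forests-col []          g = refl
  forests-col (false ∷ s) g = begin
    _ ≡⟨ ∑-map (attach 0) (forests s) _ ⟩
    _ ≡⟨ ∑-cong (forests s) (λ F → dropLast-step 0 F g) ⟩
    ∑ (forests s) g ≡⟨ +-identityʳ _ ⟨
    _ ∎
  forests-col (true ∷ s)  g = begin
    _ ≡⟨ ∑-map (attach (suc (depth s))) (predecessors s) _ ⟩
    _ ≡⟨ ∑-cong (predecessors s) (λ F → dropLast-step (suc (depth s)) F g) ⟩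
    ∑ (predecessors s) g ≡⟨ ∑-predecessors s g ⟩
    ∑ (forests s) g + ∑ (raise s) (λ t → ∑ (forests t) g) ≡⟨ cong (∑ (forests s) g +_) (∑-map (_ ,_) (raise s) _) ⟨
    _ ∎

  forests-row : ∀ a {n} (s : Vec Bool n) → Rooted s → ∀ g →
    ∑ (forests s) (λ y → ∑ (afterRow forestMachine a y) g) ≡ ∑ (afterRow labelMachine a (_ , s)) (λ t → ∑ (forests (proj₂ t)) g)
  forests-row a []        r g = begin
    (g (addLeaves a tt (ε ▷[ tt ] ε)) + 0) + 0 ≡⟨ +-identityʳ _ ⟩
    ∑ (forests {1} (true ∷ [])) (g ∘ addLeaves a tt) ≡⟨ ∑-addLeaves a (true ∷ []) g ⟨
    ∑ (forests (falses a (true ∷ []))) g ≡⟨ +-identityʳ _ ⟨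
    _ ∎
  forests-row a s@(b ∷ s′) r g = begin
    ∑ (forests s) (λ y → ∑ (afterRow forestMachine a y) g)
      -- The improper cut adds the new root as a leaf, which is the label `false ∷ s`; the proper
      -- cuts are the joins, which give `true ∷ s`.
      ≡⟨ ∑-cong (forests s) (λ F → ∑-map (insertRow a tt) (splits F) g) ⟩
    ∑ (forests s) (λ F → g (addLeaves a tt (attach 0 F)) + ∑ (proper F) (g ∘ addLeaves a tt ∘ joinTrees))
      ≡⟨ ∑-+ (forests s) (g ∘ addLeaves a tt ∘ attach 0) (λ F → ∑ (proper F) (g ∘ addLeaves a tt ∘ joinTrees)) ⟩
    ∑ (forests s) (g ∘ addLeaves a tt ∘ attach 0) + ∑ (forests s) (λ F → ∑ (proper F) (g ∘ addLeaves a tt ∘ joinTrees))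
      ≡⟨ cong₂ _+_ (sym (∑-map (attach 0) (forests s) (g ∘ addLeaves a tt))) (joins b s′ r (g ∘ addLeaves a tt)) ⟩
    ∑ (forests (false ∷ s)) (g ∘ addLeaves a tt) + ∑ (forests (true ∷ s)) (g ∘ addLeaves a tt)
      ≡⟨ cong₂ _+_ (∑-addLeaves a (false ∷ s) g) (∑-addLeaves a (true ∷ s) g) ⟨
    ∑ (forests (falses a (false ∷ s))) g + ∑ (forests (falses a (true ∷ s))) g
      ≡⟨ cong (∑ (forests (falses a (false ∷ s))) g +_) (+-identityʳ _) ⟨
    _ ∎

  runs-forests : ∀ p → runs forestMachine p ε ≡ runs labelMachine p (_ , [])
  runs-forests p = trans (sym (∑-[ ε ] (runs forestMachine p)))
    (Expansion.runs-expand forestMachine forests forests-weight forests-row forests-col p [] tt)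

-- Restriction to small letters and extension by a largest one

below : ℕ → List ℕ → List ℕ
below h = filter (_<? h)

count : ℕ → List ℕ → ℕ
count h xs = length (filter (_≟ h) xs)

filter-⊆ : ∀ {P Q : Pred ℕ 0ℓ} (P? : Decidable P) (Q? : Decidable Q) → P ⊆ Q → ∀ xs →
  filter P? (filter Q? xs) ≡ filter P? xs
filter-⊆ P? Q? P⊆Q []       = refl
filter-⊆ P? Q? P⊆Q (x ∷ xs) with Q? x
... | no ¬q = trans (filter-⊆ P? Q? P⊆Q xs) (sym (filter-reject P? (¬q ∘ P⊆Q)))
... | yes q with P? x
...   | yes p = cong (x ∷_) (filter-⊆ P? Q? P⊆Q xs)
...   | no ¬p = filter-⊆ P? Q? P⊆Q xs

below-below : ∀ h xs → below h (below (suc h) xs) ≡ below h xs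
below-below h = filter-⊆ (_<? h) (_<? suc h) m<n⇒m<1+n

count-below : ∀ h xs → count h (below (suc h) xs) ≡ count h xs
count-below h xs = cong length (filter-⊆ (_≟ h) (_<? suc h) (λ { refl → n<1+n h }) xs)

below-suc-absent : ∀ h xs → count h xs ≡ 0 → below (suc h) xs ≡ below h xs
below-suc-absent h []       e = refl
below-suc-absent h (x ∷ xs) e with x <? h
... | yes x<h = trans (filter-accept (_<? suc h) (m<n⇒m<1+n x<h))
    (trans (cong (x ∷_) (below-suc-absent h xs (trans (cong length (sym (filter-reject (_≟ h) (<⇒≢ x<h)))) e)))
           (sym (filter-accept (_<? h) x<h)))
... | no x≮h with x ≟ h
...   | yes refl with () ← trans (sym (cong length (filter-accept (_≟ h) {xs = xs} refl))) e
...   | no x≢h = trans (filter-reject (_<? suc h) (λ x<1+h → x≮h (≤∧≢⇒< (s≤s⁻¹ x<1+h) x≢h)))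
    (trans (below-suc-absent h xs (trans (cong length (sym (filter-reject (_≟ h) x≢h))) e))
           (sym (filter-reject (_<? h) x≮h)))

count-absent : ∀ h {xs} → All (_< h) xs → count h xs ≡ 0
count-absent h <h = cong length (filter-none (_≟ h) (All.map <⇒≢ <h))

record Extends (h a : ℕ) (w w′ : List ℕ) : Set where
  constructor extends
  field
    restriction  : below h w′ ≡ w
    multiplicity : count h w′ ≡ a
    bounded      : All (_< suc h) w′

open Extends

-- Runs along the border and the words they record

-- States are kept apart from their words because the insertions for {231,221} are read off a
-- forest. Completeness and uniqueness of insertions are nevertheless demanded of the words, since
-- these are what a filling determines. As in the machines, `insert a` adds `a + 1` letters.
record Model (Excludes : List ℕ → Set) : Set₁ where
  field
    Carrier  : Set
    toWord : Carrier → List ℕ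
    start  : Carrier
    insert : ℕ → ℕ → Carrier → List Carrier
    remove : Carrier → Carrier
    Valid  : ℕ → Carrier → Set
    valid-start     : Valid 0 start
    toWord-start    : toWord start ≡ []
    valid-suc       : ∀ {h s} → Valid h s → Valid (suc h) s
    valid-bounded   : ∀ {h s} → Valid h s → All (_< h) (toWord s)
    valid-avoids    : ∀ {h s} → Valid h s → Excludes (toWord s)
    valid-remove    : ∀ {h s c w} → Valid h s → toWord s ≡ c ∷ w → Valid h (remove s)
    toWord-remove   : ∀ {s c w} → toWord s ≡ c ∷ w → toWord (remove s) ≡ w
    valid-insert    : ∀ {h a s t} → Valid h s → t ∈ insert a h s → Valid (suc h) t
    insert-extends  : ∀ {h a s t} → Valid h s → t ∈ insert a h s → Extends h (suc a) (toWord s) (toWord t)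
    insert-complete : ∀ {h a s w} → Valid h s → Extends h (suc a) (toWord s) w → Excludes w →
                      ∃ λ t → t ∈ insert a h s × toWord t ≡ w
    insert-unique   : ∀ {h a s} → Valid h s → Unique (map toWord (insert a h s))

module BorderWords {Excludes : List ℕ → Set} where

  -- Here `h` rows have been entered and `xs` gives, from right to left, the rows of the ones in the
  -- columns not yet left. Thus `below h xs` is the word of the current rectangle, and a column may
  -- be left only after its one has been met.
  Fit : ℕ → List Step → List ℕ → Set
  Fit h []          xs       = xs ≡ []
  Fit h (row a ∷ p) xs       = count h xs ≡ a × Excludes (below (suc h) xs) × Fit (suc h) p xs
  Fit h (col ∷ p)   []       = ⊥
  Fit h (col ∷ p)   (c ∷ xs) = c < h × Fit h p xs

ifEmpty : List ℕ → List (List ℕ)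
ifEmpty []      = [ [] ]
ifEmpty (_ ∷ _) = []

prependHead : List ℕ → List (List ℕ) → List (List ℕ)
prependHead []      xss = []
prependHead (c ∷ _) xss = map (c ∷_) xss

module WordRuns {Excludes : List ℕ → Set} (M : Model Excludes) where
  open Model M
  open BorderWords {Excludes} public

  wordRuns : ℕ → List Step → Carrier → List (List ℕ)
  wordRuns h []                s = ifEmpty (toWord s)
  wordRuns h (row zero    ∷ p) s = wordRuns (suc h) p s
  wordRuns h (row (suc a) ∷ p) s = concatMap (wordRuns (suc h) p) (insert a h s)
  wordRuns h (col ∷ p)         s = prependHead (toWord s) (wordRuns h p (remove s))

  -- The invariant is that the current state is the recorded word restricted to the rows entered so
  -- far; counts and avoidance are then inherited from the state after each row.
  wordRuns-sound : ∀ h p {s xs} → Valid h s → xs ∈ wordRuns h p s → below h xs ≡ toWord s × Fit h p xs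
  wordRuns-sound h [] {s} v xs∈ with toWord s
  wordRuns-sound h [] {s} v (here refl) | [] = refl , refl
  wordRuns-sound h (row zero ∷ p) {s} {xs} v xs∈
    with e , f ← wordRuns-sound (suc h) p (valid-suc v) xs∈ =
      trans (sym (below-below h xs)) (trans (cong (below h) e) (filter-all (_<? h) (valid-bounded v))) ,
      trans (sym (count-below h xs)) (trans (cong (count h) e) (count-absent h (valid-bounded v))) ,
      subst Excludes (sym e) (valid-avoids v) , f
  wordRuns-sound h (row (suc a) ∷ p) {s} {xs} v xs∈
    with t , t∈ , xs∈t ← find (∈-concatMap⁻ (wordRuns (suc h) p) {xs = insert a h s} xs∈)
    with e , f ← wordRuns-sound (suc h) p (valid-insert v t∈) xs∈t =
      trans (sym (below-below h xs)) (trans (cong (below h) e) (restriction ext)) ,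
      trans (sym (count-below h xs)) (trans (cong (count h) e) (multiplicity ext)) ,
      subst Excludes (sym e) (valid-avoids (valid-insert v t∈)) , f
    where ext = insert-extends v t∈
  wordRuns-sound h (col ∷ p) {s} v xs∈ with toWord s in eq
  ... | c ∷ w with ys , ys∈ , refl ← ∈-map⁻ (c ∷_) xs∈
    with e , f ← wordRuns-sound h p (valid-remove v eq) ys∈ =
      trans (filter-accept (_<? h) c<h) (cong (c ∷_) (trans e (toWord-remove eq))) , c<h , f
    where c<h = All.head (subst (All (_< h)) eq (valid-bounded v))

  -- A word forces its run: after entering row `h` the state must have the word `below (suc h) xs`,
  -- which `insert-complete` supplies.
  wordRuns-complete : ∀ h p {s xs} → Valid h s → below h xs ≡ toWord s → Fit h p xs → xs ∈ wordRuns h p s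
  wordRuns-complete h [] v e refl rewrite sym e = here refl
  wordRuns-complete h (row zero ∷ p) {s} {xs} v e (k , av , f) =
    wordRuns-complete (suc h) p (valid-suc v) (trans (below-suc-absent h xs k) e) f
  wordRuns-complete h (row (suc a) ∷ p) {s} {xs} v e (k , av , f)
    with t , t∈ , et ← insert-complete v
           (extends (trans (below-below h xs) e) (trans (count-below h xs) k) (All.all-filter (_<? suc h) xs)) av =
    ∈-concatMap⁺ (wordRuns (suc h) p) (lose t∈ (wordRuns-complete (suc h) p (valid-insert v t∈) (sym et) f))
  wordRuns-complete h (col ∷ p) {s} {c ∷ xs} v e (c<h , f)
    with eq ← trans (sym e) (filter-accept (_<? h) c<h) rewrite eq =
    ∈-map⁺ (c ∷_) (wordRuns-complete h p (valid-remove v eq) (sym (toWord-remove eq)) f)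

  -- Different insertions lead to disjoint lists, because by soundness each recorded word reveals
  -- the word of the state just after the insertion.
  wordRuns-unique : ∀ h p {s} → Valid h s → Unique (wordRuns h p s)
  wordRuns-unique h [] {s} v with toWord s
  ... | []    = [] ∷ []
  ... | _ ∷ _ = []
  wordRuns-unique h (row zero ∷ p) v = wordRuns-unique (suc h) p (valid-suc v)
  wordRuns-unique h (row (suc a) ∷ p) {s} v =
    Unique.concat⁺
      (All.map⁺ (All.tabulate λ t∈ → wordRuns-unique (suc h) p (valid-insert v t∈)))
      (AllPairs.map⁺ (disjoint (λ t∈ → t∈) (AllPairs.map⁻ (insert-unique {a = a} v))))
    where
    disjoint : ∀ {ts} → (∀ {t} → t ∈ ts → t ∈ insert a h s) → AllPairs (λ t u → toWord t ≢ toWord u) ts →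
      AllPairs (λ t u → ∀ {xs} → ¬ (xs ∈ wordRuns (suc h) p t × xs ∈ wordRuns (suc h) p u)) ts
    disjoint ts⊆ []         = []
    disjoint ts⊆ (t≢ ∷ ts≢) =
      All.tabulate (λ u∈ (xs∈t , xs∈u) → All.lookup t≢ u∈
        (trans (sym (proj₁ (wordRuns-sound (suc h) p (valid-insert v (ts⊆ (here refl))) xs∈t)))
               (proj₁ (wordRuns-sound (suc h) p (valid-insert v (ts⊆ (there u∈))) xs∈u)))) ∷
      disjoint (ts⊆ ∘ there) ts≢
  wordRuns-unique h (col ∷ p) {s} v with toWord s in eq
  ... | []    = []
  ... | c ∷ _ = Unique.map⁺ ∷-injectiveʳ (wordRuns-unique h p (valid-remove v eq))

length-concatMap-∑ : ∀ {A B : Set} (f : A → List B) xs → length (concatMap f xs) ≡ ∑ xs (length ∘ f)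
length-concatMap-∑ f []       = refl
length-concatMap-∑ f (x ∷ xs) = trans (length-++ (f x)) (cong (length (f x) +_) (length-concatMap-∑ f xs))

module Simulation {Excludes : List ℕ → Set} (M : Model Excludes) (N : Machine)
  (shape : Model.Carrier M → Machine.State N)
  (shape-weight : ∀ {h s} → Model.Valid M h s → length (ifEmpty (Model.toWord M s)) ≡ Machine.weight N (shape s))
  (shape-insert : ∀ {h s} a → Model.Valid M h s → ∀ g →
    ∑ (Model.insert M a h s) (g ∘ shape) ≡ ∑ (Machine.afterRow N a (shape s)) g)
  (shape-empty : ∀ {s} → Model.toWord M s ≡ [] → Machine.afterCol N (shape s) ≡ [])
  (shape-remove : ∀ {s c w} → Model.toWord M s ≡ c ∷ w → Machine.afterCol N (shape s) ≡ [ shape (Model.remove M s) ])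
  where
  open Model M
  open WordRuns M

  length-wordRuns : ∀ h p {s} → Valid h s → length (wordRuns h p s) ≡ Machine.runs N p (shape s)
  length-wordRuns h [] v = shape-weight v
  length-wordRuns h (row zero ∷ p) v = length-wordRuns (suc h) p (valid-suc v)
  length-wordRuns h (row (suc a) ∷ p) {s} v = trans (length-concatMap-∑ (wordRuns (suc h) p) (insert a h s))
    (trans (∑-congᴬ (All.tabulate λ t∈ → length-wordRuns (suc h) p (valid-insert v t∈)))
           (shape-insert a v (Machine.runs N p)))
  length-wordRuns h (col ∷ p) {s} v with toWord s in eq
  ... | [] rewrite shape-empty eq = refl
  ... | c ∷ w rewrite shape-remove eq =
    trans (length-map (c ∷_) (wordRuns h p (remove s))) (trans (length-wordRuns h p (valid-remove v eq)) (sym (+-identityʳ _)))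

-- Excluded patterns and the positions of a new largest letter

-- Words are reversed, so that R a b c constrains a letter a followed later by b and then by c.
Excludes : (ℕ → ℕ → ℕ → Set) → List ℕ → Set
Excludes R []      = ⊤
Excludes R (c ∷ w) = AllPairs (λ b a → ¬ R a b c) w × Excludes R w

-- The weak inequality merges the two patterns: `c < a` is 312 and `c ≡ a` is 212.
Pattern312 : ℕ → ℕ → ℕ → Set
Pattern312 a b c = b < c × c ≤ a

count-accept : ∀ h xs → count h (h ∷ xs) ≡ suc (count h xs)
count-accept h xs = cong length (filter-accept (_≟ h) {xs = xs} refl)

count-reject : ∀ {h x} → x < h → ∀ xs → count h (x ∷ xs) ≡ count h xs
count-reject {h} x<h xs = cong length (filter-reject (_≟ h) {xs = xs} (<⇒≢ x<h))

extends-top : ∀ {h a w w′} → Extends h a w w′ → Extends h (suc a) w (h ∷ w′)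
extends-top {h} (extends r m b) =
  extends (trans (filter-reject (_<? h) (n≮n h)) r) (trans (count-accept h _) (cong suc m)) (n<1+n h ∷ b)

extends-cons : ∀ {h a d w w′} → d < h → Extends h a w w′ → Extends h a (d ∷ w) (d ∷ w′)
extends-cons {h} d<h (extends r m b) =
  extends (trans (filter-accept (_<? h) d<h) (cong (_ ∷_) r)) (trans (count-reject d<h _) m) (m<n⇒m<1+n d<h ∷ b)

extends-refl : ∀ {h w} → All (_< h) w → Extends h 0 w w
extends-refl <h = extends (filter-all _ <h) (count-absent _ <h) (All.map m<n⇒m<1+n <h)

extends-replicate : ∀ a {h n w w′} → Extends h n w w′ → Extends h (a + n) w (replicate a h ++ w′)
extends-replicate zero    e = e
extends-replicate (suc a) e = extends-top (extends-replicate a e)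

extends-++ : ∀ {h a v w w′} → All (_< h) v → Extends h a w w′ → Extends h a (v ++ w) (v ++ w′)
extends-++ []         e = e
extends-++ (d<h ∷ <h) e = extends-cons d<h (extends-++ <h e)

data Decomposition (h : ℕ) : ℕ → List ℕ → List ℕ → Set where
  nil  : Decomposition h 0 [] []
  top  : ∀ {a w w′} → Extends h a w w′ → Decomposition h (suc a) w (h ∷ w′)
  cons : ∀ {a d w w′} → d < h → Extends h a w w′ → Decomposition h a (d ∷ w) (d ∷ w′)

decompose : ∀ {h a w w′} → Extends h a w w′ → Decomposition h a w w′
decompose {w′ = []} (extends refl refl []) = nil
decompose {h} {w′ = x ∷ w′} (extends r m (x< ∷ b)) with x ≟ h
decompose {h} {w′ = x ∷ w′} (extends refl refl (x< ∷ b)) | yes refl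
  rewrite filter-reject (_<? x) {xs = w′} (n≮n x) | count-accept x w′ = top (extends refl refl b)
decompose {h} {w′ = x ∷ w′} (extends refl refl (x< ∷ b)) | no x≢h
  rewrite filter-accept (_<? h) {xs = w′} (≤∧≢⇒< (s≤s⁻¹ x<) x≢h) | count-reject (≤∧≢⇒< (s≤s⁻¹ x<) x≢h) w′
  = cons (≤∧≢⇒< (s≤s⁻¹ x<) x≢h) (extends refl refl b)

unextended : ∀ {h w w′} → Extends h 0 w w′ → w′ ≡ w
unextended {w′ = []}    e with decompose e
... | nil = refl
unextended {w′ = _ ∷ _} e with decompose e
... | cons _ e′ = cong (_ ∷_) (unextended e′)

top-∈ : ∀ {h a w w′} → Extends h (suc a) w w′ → h ∈ w′
top-∈ {w′ = []}    e with () ← Extends.multiplicity e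
top-∈ {w′ = _ ∷ _} e with decompose e
... | top e′    = here refl
... | cons _ e′ = there (top-∈ e′)

-- Words avoiding {312,212}

module Model312 where

  -- Behind a new largest letter the word has to decrease weakly. Read in reverse, the block may
  -- thus move on only while the letters increase weakly; `c` is the letter passed last.
  insertFrom  : ℕ → ℕ → ℕ → List ℕ → List (List ℕ)
  insertLater : ℕ → ℕ → ℕ → List ℕ → List (List ℕ)
  insertFrom  a h c w = (replicate a h ++ w) ∷ insertLater a h c w
  insertLater a h c []      = []
  insertLater a h c (d ∷ w) with c ≤? d
  ... | yes _ = map (d ∷_) (insertFrom a h d w)
  ... | no  _ = []

  Free : ℕ → List ℕ → Set
  Free c = AllPairs (λ b a → ¬ Pattern312 a b c)

  mutual
    insert-extends : ∀ {a h c w y} → All (_< h) w → y ∈ insertFrom a h c w → Extends h a w y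
    insert-extends {a} {h} {w = w} <h (here refl) =
      subst (λ n → Extends h n w (replicate a h ++ w)) (+-identityʳ a) (extends-replicate a (extends-refl <h))
    insert-extends <h (there y∈) = insertLater-extends <h y∈

    insertLater-extends : ∀ {a h c w y} → All (_< h) w → y ∈ insertLater a h c w → Extends h a w y
    insertLater-extends {c = c} {w = d ∷ w} (d<h ∷ <h) y∈ with c ≤? d
    ... | yes _ with _ , z∈ , refl ← ∈-map⁻ (d ∷_) y∈ = extends-cons d<h (insert-extends <h z∈)

  free-replicate : ∀ {c h w} a → c ≤ h → Free c w → Free c (replicate a h ++ w)
  free-replicate zero    c≤h f = f
  free-replicate (suc a) c≤h f = All.universal (λ _ (h<c , _) → ≤⇒≯ c≤h h<c) _ ∷ free-replicate a c≤h f

  insert-free : ∀ {a h c₀ c w y} → c₀ ≤ c → c ≤ h → All (_< h) w → Free c₀ w → y ∈ insertFrom a h c w → Free c₀ y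
  insert-free {a} c₀≤c c≤h <h f (here refl) = free-replicate a (≤-trans c₀≤c c≤h) f
  insert-free {c = c} {w = d ∷ w} c₀≤c c≤h (d<h ∷ <h) (_ ∷ f) (there y∈) with c ≤? d
  ... | yes c≤d with _ , z∈ , refl ← ∈-map⁻ (d ∷_) y∈ =
    All.universal (λ _ (d<c₀ , _) → ≤⇒≯ (≤-trans c₀≤c c≤d) d<c₀) _ ∷
    insert-free (≤-trans c₀≤c c≤d) (<⇒≤ d<h) <h f z∈

  replicate-avoids : ∀ a {h w} → All (_< h) w → Excludes Pattern312 w → Excludes Pattern312 (replicate a h ++ w)
  replicate-avoids zero    <h av = av
  replicate-avoids (suc a) <h av = free-replicate a ≤-refl (low <h) , replicate-avoids a <h av
    where
    low : ∀ {h w} → All (_< h) w → Free h w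
    low []         = []
    low (_ ∷ <h) = All.map (λ a<h (_ , h≤a) → <⇒≱ a<h h≤a) <h ∷ low <h

  insert-avoids : ∀ {a h c w y} → All (_< h) w → Excludes Pattern312 w → y ∈ insertFrom a h c w → Excludes Pattern312 y
  insert-avoids {a} <h av (here refl) = replicate-avoids a <h av
  insert-avoids {c = c} {w = d ∷ w} (d<h ∷ <h) (f , av) (there y∈) with c ≤? d
  ... | yes c≤d with _ , z∈ , refl ← ∈-map⁻ (d ∷_) y∈ =
    insert-free ≤-refl (<⇒≤ d<h) <h f z∈ , insert-avoids <h av z∈

  -- An `h` with a smaller letter behind it would form the pattern with a further `h` at the end, so
  -- all copies stand together at the end of the word.
  block : ∀ {h a w w′} → Extends h a w w′ → Free h w′ → w′ ≡ replicate a h ++ w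
  block {a = zero}  e f = unextended e
  block {a = suc a} {w′ = w′} e f with w′ | decompose e | f
  ... | _ | top e′      | _ ∷ f′ = cong (_ ∷_) (block e′ f′)
  ... | _ | cons d<h e′ | f₀ ∷ _ = ⊥-elim (All.lookup f₀ (top-∈ e′) (d<h , ≤-refl))

  insert-complete : ∀ {a h c w w′} → c ≤ h → Extends h (suc a) w w′ → Free c w′ → Excludes Pattern312 w′ → w′ ∈ insertFrom (suc a) h c w
  insert-complete {w′ = []} c≤h e f av with () ← Extends.multiplicity e
  insert-complete {a} {h} {c} {w′ = _ ∷ _} c≤h e (f₀ ∷ f) (fd , av) with decompose e
  ... | top e′ = here (cong (h ∷_) (block e′ fd))
  ... | cons {d = d} d<h e′ with c ≤? d
  ...   | yes c≤d = there (∈-map⁺ (d ∷_) (insert-complete (<⇒≤ d<h) e′ fd av))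
  -- Here a copy of `h` is followed by `d` and then by `c` with `d < c ≤ h`, which `Free c` forbids.
  ...   | no  c≰d = ⊥-elim (All.lookup f₀ (top-∈ e′) (≰⇒> c≰d , c≤h))

  insert-unique : ∀ {a h} c {w} → All (_< h) w → Unique (insertFrom (suc a) h c w)
  insert-unique {a} {h} c {[]}    <h         = [] ∷ []
  insert-unique {a} {h} c {d ∷ w} (d<h ∷ <h) with c ≤? d
  ... | yes _ = All.map⁺ (All.universal (λ _ e → <⇒≢ d<h (sym (∷-injectiveˡ e))) _) ∷ Unique.map⁺ ∷-injectiveʳ (insert-unique d <h)
  ... | no  _ = [] ∷ []

  isAscent : ℕ → List ℕ → Bool
  isAscent d []      = true
  isAscent d (e ∷ w) with d ≤? e
  ... | yes _ = false
  ... | no  _ = true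

  -- The first letter of the word counts as an ascent.
  ascents : List ℕ → List Bool
  ascents []      = []
  ascents (d ∷ w) = isAscent d w ∷ ascents w

  free-0 : ∀ w → Free 0 w
  free-0 []      = []
  free-0 (_ ∷ w) = All.universal (λ { _ (() , _) }) w ∷ free-0 w

  tail : List ℕ → List ℕ
  tail []      = []
  tail (_ ∷ w) = w

  model : Model (Excludes Pattern312)
  model = record
    { Carrier = List ℕ
    ; toWord = id
    ; start = []
    -- At the end of the word no letter has been passed yet; the bound 0 lets the block move past
    -- the last letter freely.
    ; insert = λ a h → insertFrom (suc a) h 0
    ; remove = tail
    ; Valid = λ h w → All (_< h) w × Excludes Pattern312 w
    ; valid-start = [] , tt
    ; toWord-start = refl
    ; valid-suc = λ (<h , av) → All.map m<n⇒m<1+n <h , av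
    ; valid-bounded = proj₁
    ; valid-avoids = proj₂
    ; valid-remove = λ { (_ ∷ <h , _ , av) refl → <h , av }
    ; toWord-remove = λ { refl → refl }
    ; valid-insert = λ (<h , av) y∈ → Extends.bounded (insert-extends <h y∈) , insert-avoids <h av y∈
    ; insert-extends = λ (<h , av) y∈ → insert-extends <h y∈
    ; insert-complete = λ _ e av → _ , insert-complete z≤n e (free-0 _) av , refl
    ; insert-unique = λ (<h , av) → Unique.map⁺ id (insert-unique 0 <h)
    }

  isAscent-top : ∀ {h} {w} → All (_< h) w → isAscent h w ≡ true
  isAscent-top []         = refl
  isAscent-top {h} (_∷_ {x = e} e<h _) with h ≤? e
  ... | yes h≤e = ⊥-elim (<⇒≱ e<h h≤e)
  ... | no  _   = refl

  isAscent-≤ : ∀ {d e} w → d ≤ e → isAscent d (e ∷ w) ≡ false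
  isAscent-≤ {d} {e} w d≤e with d ≤? e
  ... | yes _   = refl
  ... | no  d≰e = ⊥-elim (d≰e d≤e)

  ascents-block : ∀ a {h w} → All (_< h) w → ascents (replicate (suc a) h ++ w) ≡ prependFalses a (true ∷ ascents w)
  ascents-block zero        <h = cong (_∷ _) (isAscent-top <h)
  ascents-block (suc a) {h} {w} <h = cong₂ _∷_ (isAscent-≤ (replicate a h ++ w) ≤-refl) (ascents-block a <h)

  open ≡-Reasoning

  -- These are the insertions beyond `d`. The one that takes over the ascent starting the final run
  -- is reached last by the recursion but stands apart in `ascentMachine`, so it is carried along as
  -- a separate summand and moved by commutativity.
  ∑-insertFrom : ∀ a {h d} w → d < h → All (_< h) w → ∀ g →
    ∑ (insertFrom (suc a) h d w) (g ∘ ascents ∘ (d ∷_)) ≡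
    g (prependFalses a (false ∷ ascents (d ∷ w))) + ∑ (insertAscentLater (ascents (d ∷ w))) (g ∘ prependFalses a)
  ∑-insertFrom a {h} {d} w d<h <h g = trans (cong (λ u → g u + ∑ (insertLater (suc a) h d w) (g ∘ ascents ∘ (d ∷_))) first) (rest w <h)
    where
    first : ascents (d ∷ replicate (suc a) h ++ w) ≡ prependFalses a (false ∷ true ∷ ascents w)
    first = trans (cong₂ _∷_ (isAscent-≤ (replicate a h ++ w) (<⇒≤ d<h)) (ascents-block a <h)) (prependFalses-comm a (true ∷ ascents w))

    rest : ∀ w → All (_< h) w →
      g (prependFalses a (false ∷ true ∷ ascents w)) + ∑ (insertLater (suc a) h d w) (g ∘ ascents ∘ (d ∷_)) ≡
      g (prependFalses a (false ∷ ascents (d ∷ w))) + ∑ (insertAscentLater (ascents (d ∷ w))) (g ∘ prependFalses a)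
    rest []      <h         = refl
    rest (e ∷ w) (e<h ∷ <h) with d ≤? e
    ... | no  _   = refl
    ... | yes d≤e = begin
      g (F (false ∷ true ∷ u)) + ∑ (map (e ∷_) (insertFrom (suc a) h e w)) (g ∘ ascents ∘ (d ∷_))
        ≡⟨ cong (g (F (false ∷ true ∷ u)) +_) (begin
             _ ≡⟨ ∑-map (e ∷_) (insertFrom (suc a) h e w) _ ⟩
             _ ≡⟨ ∑-cong (insertFrom (suc a) h e w) (λ y → cong (λ b → g (b ∷ ascents (e ∷ y))) (isAscent-≤ y d≤e)) ⟩
             _ ≡⟨ ∑-insertFrom a w e<h <h (g ∘ (false ∷_)) ⟩
             _ ≡⟨ cong₂ _+_ (cong g (prependFalses-comm a (false ∷ u))) (∑-cong (insertAscentLater u) (λ v → cong g (prependFalses-comm a v))) ⟩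
             _ ∎) ⟩
      g (F (false ∷ true ∷ u)) + (g (F (false ∷ false ∷ u)) + ∑ (insertAscentLater u) (g ∘ F ∘ (false ∷_)))
        ≡⟨ solve 3 (λ x y z → x :+ (y :+ z) := y :+ (x :+ z)) refl (g (F (false ∷ true ∷ u))) (g (F (false ∷ false ∷ u))) _ ⟩
      g (F (false ∷ false ∷ u)) + ∑ (insertAscent u) (g ∘ F ∘ (false ∷_))
        ≡⟨ cong (g (F (false ∷ false ∷ u)) +_) (∑-map (false ∷_) (insertAscent u) (g ∘ F)) ⟨
      _ ∎
      where
      open +-*-Solver
      F = prependFalses a
      u = ascents (e ∷ w)

  ∑-insert : ∀ {h} a w → All (_< h) w → ∀ g →
    ∑ (insertFrom (suc a) h 0 w) (g ∘ ascents) ≡ ∑ (Machine.afterRow ascentMachine a (ascents w)) g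
  ∑-insert {h} a [] <h g = cong (λ u → g u + 0) (ascents-block a <h)
  ∑-insert {h} a (d ∷ w) (d<h ∷ <h) g = begin
    g (ascents (replicate (suc a) h ++ d ∷ w)) + ∑ (map (d ∷_) (insertFrom (suc a) h d w)) (g ∘ ascents)
      ≡⟨ cong₂ _+_ (cong g (ascents-block a (d<h ∷ <h)))
           (trans (∑-map (d ∷_) (insertFrom (suc a) h d w) (g ∘ ascents)) (∑-insertFrom a w d<h <h g)) ⟩
    g (F (true ∷ u)) + (g (F (false ∷ u)) + ∑ (insertAscentLater u) (g ∘ F))
      ≡⟨ solve 3 (λ x y z → x :+ (y :+ z) := y :+ (x :+ z)) refl (g (F (true ∷ u))) (g (F (false ∷ u))) _ ⟩
    g (F (false ∷ u)) + ∑ (insertAscent u) (g ∘ F)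
      ≡⟨ cong (g (F (false ∷ u)) +_) (∑-map F (insertAscent u) g) ⟨
    _ ∎
    where
    open +-*-Solver
    F = prependFalses a
    u = ascents (d ∷ w)

  ascents-weight : ∀ w → length (ifEmpty w) ≡ Machine.weight ascentMachine (ascents w)
  ascents-weight []      = refl
  ascents-weight (_ ∷ _) = refl

  ascents-empty : ∀ {w} → w ≡ [] → Machine.afterCol ascentMachine (ascents w) ≡ []
  ascents-empty refl = refl

  ascents-tail : ∀ {u c w} → u ≡ c ∷ w → Machine.afterCol ascentMachine (ascents u) ≡ [ ascents (tail u) ]
  ascents-tail refl = refl

  length-wordRuns : ∀ p → length (WordRuns.wordRuns model 0 p []) ≡ Machine.runs labelMachine p (_ , [])
  length-wordRuns p = trans (S.length-wordRuns 0 p ([] , tt)) (Ascents.runs-ascents p)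
    where
    module S = Simulation model ascentMachine ascents
      (λ {_} {w} _ → ascents-weight w) (λ a v → ∑-insert a _ (proj₁ v)) ascents-empty ascents-tail

-- Words avoiding {231,221}

Pattern231 : ℕ → ℕ → ℕ → Set
Pattern231 a b c = c < a × a ≤ b

module Model231 where

  flatten : Forest ℕ → List ℕ
  flatten ε            = []
  flatten (F ▷[ a ] C) = flatten C ++ a ∷ flatten F

  -- A letter at least as large as the preceding root starts a new tree, hence the strict bound
  -- below a root and the weak bound to its left. The last condition forbids a letter of `F`, then
  -- the root, then a smaller descendant.
  data Ordered : Forest ℕ → Set where
    ε    : Ordered ε
    node : ∀ {F a C} → Ordered F → Ordered C → All (_< a) (flatten C) → All (_≤ a) (flatten F) →
           All (λ c → All (_≤ c) (flatten F)) (flatten C) → Ordered (F ▷[ a ] C)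

  noneBelow : ∀ {c u} → All (_≤ c) u → AllPairs (λ b a → ¬ Pattern231 a b c) u
  noneBelow []       = []
  noneBelow (_ ∷ ≤c) = All.map (λ a≤c (c<a , _) → <⇒≱ c<a a≤c) ≤c ∷ noneBelow ≤c

  -- Consider a letter `c` of `v` as the end of an occurrence: the letters of `u` are at most `c`,
  -- so none of them can begin it, and the root `a` cannot begin it either, since only smaller
  -- letters stand between it and `c`.
  avoids-++ : ∀ {a} v u → All (_< a) v → All (_≤ a) u → All (λ c → All (_≤ c) u) v →
    Excludes Pattern231 v → Excludes Pattern231 u → Excludes Pattern231 (v ++ a ∷ u)
  avoids-++ [] u <a ≤a v≥u av au = noneBelow ≤a , au
  avoids-++ {a} (c ∷ v) u (c<a ∷ <a) ≤a (u≤c ∷ v≥u) (pc , av) au =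
    AllPairs.++⁺ pc
      (All.map (λ x≤c (c<x , _) → <⇒≱ c<x x≤c) u≤c ∷ noneBelow u≤c)
      (All.map (λ b<a → (λ (_ , a≤b) → <⇒≱ b<a a≤b) ∷ All.map (λ x≤c (c<x , _) → <⇒≱ c<x x≤c) u≤c) <a) ,
    avoids-++ v u <a ≤a v≥u av au

  ordered-avoids : ∀ {F} → Ordered F → Excludes Pattern231 (flatten F)
  ordered-avoids ε                       = tt
  ordered-avoids (node oF oC <a ≤a C≥F) = avoids-++ _ _ <a ≤a C≥F (ordered-avoids oC) (ordered-avoids oF)

  flatten-node : ∀ F a C → ∃ λ c → ∃ λ w → flatten (F ▷[ a ] C) ≡ c ∷ w
  flatten-node F a C with flatten C
  ... | []    = _ , _ , refl
  ... | _ ∷ _ = _ , _ , refl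

  flatten-dropLast : ∀ F → flatten (dropLast F) ≡ drop 1 (flatten F)
  flatten-dropLast ε            = refl
  flatten-dropLast (F ▷[ a ] ε) = refl
  flatten-dropLast (F ▷[ a ] C@(G ▷[ b ] D)) =
    trans (cong (_++ a ∷ flatten F) (flatten-dropLast C)) (drop-++ (proj₂ (proj₂ (flatten-node G b D))))
    where
    drop-++ : ∀ {c : ℕ} {v w u} → v ≡ c ∷ w → drop 1 v ++ u ≡ drop 1 (v ++ u)
    drop-++ refl = refl

  dropLast-All : ∀ {P : ℕ → Set} F → All P (flatten F) → All P (flatten (dropLast F))
  dropLast-All F ps = subst (All _) (sym (flatten-dropLast F)) (All.drop⁺ 1 ps)

  dropLast-ordered : ∀ {F} → Ordered F → Ordered (dropLast F)
  dropLast-ordered ε = ε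
  dropLast-ordered (node {C = ε} oF oC <a ≤a C≥F) = oF
  dropLast-ordered (node {C = C@(_ ▷[ _ ] _)} oF oC <a ≤a C≥F) =
    node oF (dropLast-ordered oC) (dropLast-All C <a) ≤a (dropLast-All C C≥F)

  record Split (F G C : Forest ℕ) : Set where
    field
      flatten-split : flatten F ≡ flatten C ++ flatten G
      left-ordered   : Ordered G
      right-ordered  : Ordered C
      separated      : All (λ c → All (_≤ c) (flatten G)) (flatten C)

  open Split

  splits-sound : ∀ {F G C} → Ordered F → (G , C) ∈ splits F → Split F G C
  splits-sound oF (here refl) = record { flatten-split = refl ; left-ordered = oF ; right-ordered = ε ; separated = [] }
  splits-sound (node {F} {a} {C} oF oC <a ≤a C≥F) (there p) with (G , D) , q , refl ← ∈-map⁻ (map₂ (_▷[ a ] C)) p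
    with s ← splits-sound oF q = record
    { flatten-split = trans (cong (λ w → flatten C ++ a ∷ w) (flatten-split s)) (sym (++-assoc (flatten C) (a ∷ flatten D) (flatten G)))
    ; left-ordered   = left-ordered s
    ; right-ordered  = node (right-ordered s) oC <a (All.++⁻ˡ (flatten D) ≤a′) (All.map (λ ≤c → All.++⁻ˡ (flatten D) (subst (All _) (flatten-split s) ≤c)) C≥F)
    ; separated      = All.++⁺ (All.map (λ ≤c → All.++⁻ʳ (flatten D) (subst (All _) (flatten-split s) ≤c)) C≥F)
                               (All.++⁻ʳ (flatten D) ≤a′ ∷ separated s)
    }
    where ≤a′ = subst (All _) (flatten-split s) ≤a

  prefix-compare : ∀ {A : Set} (xs : List A) {ys} v {u} → xs ++ ys ≡ v ++ u →
    (∃ λ z → v ≡ xs ++ z × ys ≡ z ++ u) ⊎ (∃ λ x → ∃ λ z → xs ≡ v ++ x ∷ z × u ≡ x ∷ z ++ ys)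
  prefix-compare []       v       e = inj₁ (v , refl , e)
  prefix-compare (x ∷ xs) []      e = inj₂ (x , xs , refl , sym e)
  prefix-compare (x ∷ xs) (y ∷ v) e with refl , e′ ← ∷-injective e with prefix-compare xs v e′
  ... | inj₁ (z , refl , q)     = inj₁ (z , refl , q)
  ... | inj₂ (w , z , refl , q) = inj₂ (w , z , refl , q)

  -- A root exceeds its descendants, so a cut separating small from large letters runs between two trees.
  splits-complete : ∀ {F} → Ordered F → ∀ v u → flatten F ≡ v ++ u → All (λ c → All (_≤ c) u) v →
    ∃ λ G → ∃ λ C → (G , C) ∈ splits F × flatten C ≡ v × flatten G ≡ u
  splits-complete {F} oF [] u e v≥u = F , ε , here refl , refl , e
  splits-complete {F ▷[ a ] D} (node oF oD <a ≤a D≥F) (c ∷ v) u e v≥u with prefix-compare (flatten D) (c ∷ v) e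
  ... | inj₂ (x , z , eD , refl) = ⊥-elim (<⇒≱ (All.head (subst (All (_< a)) eD <a))
          (All.head (All.++⁻ʳ (x ∷ z) (All.head v≥u))))
  ... | inj₁ ([] , e₁ , refl) = ⊥-elim (<⇒≱ (All.lookup <a (subst (c ∈_) (trans e₁ (++-identityʳ _)) (here refl))) (All.head (All.head v≥u)))
  ... | inj₁ (x ∷ z , e₁ , e₂) with refl , e₃ ← ∷-injective e₂
      with G , C , GC∈ , refl , refl ← splits-complete oF z u e₃
             (All.++⁻ʳ (flatten D ++ [ a ]) (subst (All _) (trans e₁ (sym (++-assoc (flatten D) [ a ] z))) v≥u)) =
    G , C ▷[ a ] D , there (∈-map⁺ (map₂ (_▷[ a ] D)) GC∈) , sym e₁ , refl

  flatten-insertRow : ∀ n h G C → flatten (insertRow n h (G , C)) ≡ replicate n h ++ flatten C ++ h ∷ flatten G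
  flatten-insertRow zero    h G C = refl
  flatten-insertRow (suc n) h G C = cong (h ∷_) (flatten-insertRow n h G C)

  addLeaves-ordered : ∀ n {h F} → All (_≤ h) (flatten F) → Ordered F → Ordered (addLeaves n h F)
  addLeaves-ordered n ≤h oF = proj₂ (both n)
    where
    both : ∀ n → All (_≤ _) (flatten (addLeaves n _ _)) × Ordered (addLeaves n _ _)
    both zero    = ≤h , oF
    both (suc n) with ≤h′ , o ← both n = ≤-refl ∷ ≤h′ , node o ε [] ≤h′ []

  Valid : ℕ → Forest ℕ → Set
  Valid h F = Ordered F × All (_< h) (flatten F)

  insertions : ℕ → ℕ → Forest ℕ → List (Forest ℕ)
  insertions a h F = map (insertRow a h) (splits F)

  split-bounded : ∀ {h F G C} → Split F G C → All (_< h) (flatten F) → All (_< h) (flatten C) × All (_< h) (flatten G)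
  split-bounded {C = C} s <h = All.++⁻ (flatten C) (subst (All _) (flatten-split s) <h)

  insert-extends : ∀ {h a F H} → Valid h F → H ∈ insertions a h F → Extends h (suc a) (flatten F) (flatten H)
  insert-extends {h} {a} {F} (oF , <h) H∈ with (G , C) , GC∈ , refl ← ∈-map⁻ (insertRow a h) H∈
    with s ← splits-sound oF GC∈ with <hC , <hG ← split-bounded s <h =
    subst₂ (Extends h (suc a)) (sym (flatten-split s)) (sym (flatten-insertRow a h G C))
      (subst (λ n → Extends h n (flatten C ++ flatten G) (replicate a h ++ flatten C ++ h ∷ flatten G)) (+-comm a 1)
        (extends-replicate a (extends-++ <hC (extends-top (extends-refl <hG)))))

  insert-valid : ∀ {h a F H} → Valid h F → H ∈ insertions a h F → Valid (suc h) H
  insert-valid {h} {a} v@(oF , <h) H∈ = ordered , Extends.bounded (insert-extends {a = a} v H∈)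
    where
    ordered : Ordered _
    ordered with (G , C) , GC∈ , refl ← ∈-map⁻ (insertRow a h) H∈
      with s ← splits-sound oF GC∈ with <hC , <hG ← split-bounded s <h =
      addLeaves-ordered a (All.++⁺ (All.map <⇒≤ <hC) (≤-refl ∷ All.map <⇒≤ <hG))
        (node (left-ordered s) (right-ordered s) <hC (All.map <⇒≤ <hG) (separated s))

  -- A smaller letter behind two copies of `h` completes 221, so all copies but the first end the
  -- word. A letter before the first copy that exceeds a letter behind it completes 231, so the
  -- first copy separates small letters from large ones.
  block : ∀ {h a w w′} → All (_< h) w → Extends h (suc a) w w′ → Excludes Pattern231 w′ →
    ∃ λ v → ∃ λ u → w′ ≡ replicate a h ++ v ++ h ∷ u × w ≡ v ++ u × All (λ c → All (_≤ c) u) v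
  block {w′ = []} <h e av with () ← Extends.multiplicity e
  block {h} {zero} {w′ = _ ∷ w′} <h e (p , av) with decompose e
  ... | top e′ = [] , w′ , refl , sym (unextended e′) , []
  ... | cons {d = d} d<h e′ with All.tail <h
  ...   | <h′ with v , u , refl , refl , v≥u ← block <h′ e′ av =
    d ∷ v , u , refl , refl , low v p <h′ ∷ v≥u
    where
    low : ∀ {h d} v {u} → AllPairs (λ b a → ¬ Pattern231 a b d) (v ++ h ∷ u) → All (_< h) (v ++ u) → All (_≤ d) u
    low []      (p ∷ _) <h       = All.zipWith (λ (a<h , ¬p) → ≮⇒≥ (λ d<a → ¬p (d<a , <⇒≤ a<h))) (<h , p)
    low (_ ∷ v) (_ ∷ p) (_ ∷ <h) = low v p <h
  block {h} {suc a} {w′ = _ ∷ w′} <h e (p , av) with decompose e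
  ... | top e′ with v , u , refl , q , v≥u ← block <h e′ av = v , u , refl , q , v≥u
  ... | cons d<h e′ = ⊥-elim (twoTops p e′ d<h)
    where
    twoTops : ∀ {w w′ d} → AllPairs (λ b a → ¬ Pattern231 a b d) w′ → Extends h (2 + a) w w′ → d < h → ⊥
    twoTops [] e d<h with () ← Extends.multiplicity e
    twoTops (p₀ ∷ p) e d<h with decompose e
    ... | top e′ = All.lookup p₀ (top-∈ e′) (d<h , ≤-refl)
    ... | cons _ e′ = twoTops p e′ d<h

  insert-complete : ∀ {h a F w} → Valid h F → Extends h (suc a) (flatten F) w → Excludes Pattern231 w →
    ∃ λ H → H ∈ insertions a h F × flatten H ≡ w
  insert-complete {h} {a} {F} (oF , <h) e av
    with v , u , refl , q , v≥u ← block <h e av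
    with G , C , GC∈ , refl , refl ← splits-complete oF v u q v≥u =
    _ , ∈-map⁺ (insertRow a h) GC∈ , flatten-insertRow a h G C

  -- As `h` exceeds all other letters, its place in the word reveals the cut.
  splits-unique : ∀ {h F} → All (_< h) (flatten F) → Unique (map (λ (G , C) → flatten C ++ h ∷ flatten G) (splits F))
  splits-unique {h} {ε}          <h = [] ∷ []
  splits-unique {h} {F ▷[ a ] D} <h =
    All.map⁺ (All.map⁺ (All.universal (λ (G , C) e → differ (flatten D) <h
      (trans e (++-assoc (flatten D) (a ∷ flatten C) (h ∷ flatten G)))) (splits F))) ∷
    subst Unique
      (trans (sym (map-∘ (splits F)))
        (trans (map-cong (λ (G , C) → sym (++-assoc (flatten D) (a ∷ flatten C) (h ∷ flatten G))) (splits F))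
               (map-∘ (splits F))))
      (Unique.map⁺ (λ e → ∷-injectiveʳ (++-cancelˡ (flatten D) _ _ e))
        (splits-unique {F = F} (All.tail (All.++⁻ʳ (flatten D) <h))))
    where
    differ : ∀ v {v′ u w} → All (_< h) (v ++ a ∷ v′) → h ∷ u ≢ v ++ a ∷ w
    differ []      (a<h ∷ _) refl = n≮n _ a<h
    differ (_ ∷ v) (c<h ∷ _) refl = n≮n _ c<h

  insert-unique : ∀ {h a F} → Valid h F → Unique (map flatten (insertions a h F))
  insert-unique {h} {a} {F} (oF , <h) =
    subst Unique
      (trans (sym (map-∘ (splits F)))
        (trans (map-cong (λ (G , C) → sym (flatten-insertRow a h G C)) (splits F)) (map-∘ (splits F))))
      (Unique.map⁺ (++-cancelˡ (replicate a h) _ _) (splits-unique {F = F} <h))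

  model : Model (Excludes Pattern231)
  model = record
    { Carrier = Forest ℕ
    ; toWord = flatten
    ; start = ε
    ; insert = insertions
    ; remove = dropLast
    ; Valid = Valid
    ; valid-start = ε , []
    ; toWord-start = refl
    ; valid-suc = λ (o , <h) → o , All.map m<n⇒m<1+n <h
    ; valid-bounded = proj₂
    ; valid-avoids = ordered-avoids ∘ proj₁
    ; valid-remove = λ {h} {F} (o , <h) _ → dropLast-ordered o , dropLast-All F <h
    ; toWord-remove = λ {F} e → trans (flatten-dropLast F) (cong (drop 1) e)
    ; valid-insert = λ {h} {a} → insert-valid {h} {a}
    ; insert-extends = insert-extends
    ; insert-complete = insert-complete
    ; insert-unique = λ {h} {a} → insert-unique {h} {a}
    }

  shape : Forest ℕ → Forest ⊤
  shape ε            = ε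
  shape (F ▷[ _ ] C) = shape F ▷[ tt ] shape C

  shape₂ : Forest ℕ × Forest ℕ → Forest ⊤ × Forest ⊤
  shape₂ (F , C) = shape F , shape C

  splits-shape : ∀ F → splits (shape F) ≡ map shape₂ (splits F)
  splits-shape ε            = refl
  splits-shape (F ▷[ a ] C) = cong ((shape (F ▷[ a ] C) , ε) ∷_) (trans (cong (map _) (splits-shape F)) (trans (sym (map-∘ (splits F))) (map-∘ (splits F))))

  shape-insertRow : ∀ n h GC → shape (insertRow n h GC) ≡ insertRow n tt (shape₂ GC)
  shape-insertRow zero    h GC = refl
  shape-insertRow (suc n) h GC = cong (_▷[ tt ] ε) (shape-insertRow n h GC)

  shape-dropLast : ∀ F → shape (dropLast F) ≡ dropLast (shape F)
  shape-dropLast ε                           = refl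
  shape-dropLast (F ▷[ a ] ε)                = refl
  shape-dropLast (F ▷[ a ] C@(_ ▷[ _ ] _)) = cong (shape F ▷[ tt ]_) (shape-dropLast C)

  shape-weight : ∀ F → length (ifEmpty (flatten F)) ≡ Machine.weight forestMachine (shape F)
  shape-weight ε            = refl
  shape-weight (F ▷[ a ] C) with flatten (F ▷[ a ] C) | flatten-node F a C
  ... | .(_ ∷ _) | _ , _ , refl = refl

  shape-empty : ∀ F → flatten F ≡ [] → Machine.afterCol forestMachine (shape F) ≡ []
  shape-empty ε            e = refl
  shape-empty (F ▷[ a ] C) e with flatten (F ▷[ a ] C) | flatten-node F a C
  shape-empty (F ▷[ a ] C) () | .(_ ∷ _) | _ , _ , refl

  shape-remove : ∀ F {c w} → flatten F ≡ c ∷ w → Machine.afterCol forestMachine (shape F) ≡ [ shape (dropLast F) ]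
  shape-remove F@(_ ▷[ _ ] _) e = cong [_] (sym (shape-dropLast F))

  shape-insert : ∀ {h} a F g → ∑ (insertions a h F) (g ∘ shape) ≡ ∑ (Machine.afterRow forestMachine a (shape F)) g
  shape-insert {h} a F g = begin
    ∑ (map (insertRow a h) (splits F)) (g ∘ shape)       ≡⟨ ∑-map (insertRow a h) (splits F) (g ∘ shape) ⟩
    ∑ (splits F) (g ∘ shape ∘ insertRow a h)             ≡⟨ ∑-cong (splits F) (cong g ∘ shape-insertRow a h) ⟩
    ∑ (splits F) (g ∘ insertRow a tt ∘ shape₂)           ≡⟨ ∑-map shape₂ (splits F) (g ∘ insertRow a tt) ⟨
    ∑ (map shape₂ (splits F)) (g ∘ insertRow a tt)       ≡⟨ cong (λ GCs → ∑ GCs (g ∘ insertRow a tt)) (splits-shape F) ⟨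
    ∑ (splits (shape F)) (g ∘ insertRow a tt)            ≡⟨ ∑-map (insertRow a tt) (splits (shape F)) g ⟨
    ∑ (map (insertRow a tt) (splits (shape F))) g        ∎
    where open ≡-Reasoning

  length-wordRuns : ∀ p → length (WordRuns.wordRuns model 0 p ε) ≡ Machine.runs labelMachine p (_ , [])
  length-wordRuns p = trans (S.length-wordRuns 0 p (ε , [])) (Forests.runs-forests p)
    where
    module S = Simulation model forestMachine shape
      (λ {_} {F} _ → shape-weight F) (λ a _ → shape-insert a _) (λ {F} → shape-empty F) (λ {F} → shape-remove F)

-- Avoidance in terms of columns

reverseWord : (ℕ → ℕ) → ℕ → List ℕ
reverseWord r n = map r (downFrom n)

module _ {r : ℕ → ℕ} {h : ℕ} where

  ∈-below : ∀ {n x} → x ∈ below h (reverseWord r n) → ∃ λ j → j < n × r j < h × x ≡ r j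
  ∈-below {n} x∈ with x∈w , x<h ← ∈-filter⁻ (_<? h) {xs = reverseWord r n} x∈
    with j , j∈ , refl ← ∈-map⁻ r x∈w = j , ∈-downFrom⁻ j∈ , x<h , refl

  below-∈ : ∀ {n j} → j < n → r j < h → r j ∈ below h (reverseWord r n)
  below-∈ j<n rj<h = ∈-filter⁺ (_<? h) (∈-map⁺ r (∈-downFrom⁺ j<n)) rj<h

  pairs⁺ : ∀ {Q : ℕ → ℕ → Set} n → (∀ {i j} → i < j → j < n → r i < h → r j < h → Q (r j) (r i)) →
    AllPairs Q (below h (reverseWord r n))
  pairs⁺ zero q = []
  pairs⁺ {Q} (suc n) q with r n <? h
  ... | yes rn<h = subst (AllPairs Q) (sym (filter-accept (_<? h) rn<h))
    (All.tabulate (λ x∈ → let (j , j<n , rj<h , e) = ∈-below {n} x∈ in subst (Q (r n)) (sym e) (q j<n (n<1+n n) rj<h rn<h)) ∷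
     pairs⁺ n (λ i<j j<n → q i<j (m<n⇒m<1+n j<n)))
  ... | no rn≮h = subst (AllPairs Q) (sym (filter-reject (_<? h) rn≮h)) (pairs⁺ n (λ i<j j<n → q i<j (m<n⇒m<1+n j<n)))

  pairs⁻ : ∀ {Q : ℕ → ℕ → Set} n → AllPairs Q (below h (reverseWord r n)) →
    ∀ {i j} → i < j → j < n → r i < h → r j < h → Q (r j) (r i)
  pairs⁻ {Q} (suc n) q {i} {j} i<j j<1+n ri<h rj<h with j ≟ n | r n <? h
  ... | yes refl | no rn≮h = ⊥-elim (rn≮h rj<h)
  ... | yes refl | yes rn<h with p ∷ _ ← subst (AllPairs Q) (filter-accept (_<? h) rn<h) q =
    All.lookup p (below-∈ i<j ri<h)
  ... | no j≢n | no rn≮h =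
    pairs⁻ n (subst (AllPairs Q) (filter-reject (_<? h) rn≮h) q) i<j (≤∧≢⇒< (s≤s⁻¹ j<1+n) j≢n) ri<h rj<h
  ... | no j≢n | yes rn<h with _ ∷ q′ ← subst (AllPairs Q) (filter-accept (_<? h) rn<h) q =
    pairs⁻ n q′ i<j (≤∧≢⇒< (s≤s⁻¹ j<1+n) j≢n) ri<h rj<h

  excludes⁺ : ∀ {R} n → (∀ {i j k} → i < j → j < k → k < n → r i < h → r j < h → r k < h → ¬ R (r i) (r j) (r k)) →
    Excludes R (below h (reverseWord r n))
  excludes⁺ zero q = tt
  excludes⁺ {R} (suc n) q with r n <? h
  ... | yes rn<h = subst (Excludes R) (sym (filter-accept (_<? h) rn<h))
    (pairs⁺ n (λ i<j j<n ri<h rj<h → q i<j j<n (n<1+n n) ri<h rj<h rn<h) ,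
     excludes⁺ n (λ i<j j<k k<n → q i<j j<k (m<n⇒m<1+n k<n)))
  ... | no rn≮h = subst (Excludes R) (sym (filter-reject (_<? h) rn≮h)) (excludes⁺ n (λ i<j j<k k<n → q i<j j<k (m<n⇒m<1+n k<n)))

  excludes⁻ : ∀ {R} n → Excludes R (below h (reverseWord r n)) →
    ∀ {i j k} → i < j → j < k → k < n → r i < h → r j < h → r k < h → ¬ R (r i) (r j) (r k)
  excludes⁻ {R} (suc n) q {k = k} i<j j<k k<1+n ri<h rj<h rk<h with k ≟ n | r n <? h
  ... | yes refl | no rn≮h = ⊥-elim (rn≮h rk<h)
  ... | yes refl | yes rn<h with p , _ ← subst (Excludes R) (filter-accept (_<? h) rn<h) q =
    pairs⁻ n p i<j j<k ri<h rj<h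
  ... | no k≢n | no rn≮h =
    excludes⁻ n (subst (Excludes R) (filter-reject (_<? h) rn≮h) q) i<j j<k (≤∧≢⇒< (s≤s⁻¹ k<1+n) k≢n) ri<h rj<h rk<h
  ... | no k≢n | yes rn<h with _ , q′ ← subst (Excludes R) (filter-accept (_<? h) rn<h) q =
    excludes⁻ n q′ i<j j<k (≤∧≢⇒< (s≤s⁻¹ k<1+n) k≢n) ri<h rj<h rk<h

-- The border of a Ferrers shape

-- After a row come the columns that end at it. Terms of `as` beyond the shape are kept as rows: a
-- positive one adds letters that no column step removes, so such a run contributes nothing, in
-- agreement with the required row sums.
border : Shape → List ℕ → List Step
border []      as = map row as
border (l ∷ Λ) as = row (term as 0) ∷ replicate (l ∸ width Λ) col ++ border Λ (drop 1 as)

term-width : ∀ {Λ} → IsFerrers Λ → ∀ i → term Λ i ≤ width Λ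
term-width []        i       = z≤n
term-width [-]       zero    = ≤-refl
term-width [-]       (suc i) = z≤n
term-width (l≥ ∷ fs) zero    = ≤-refl
term-width (l≥ ∷ fs) (suc i) = ≤-trans (term-width fs i) l≥

width-tail : ∀ {l Λ} → IsFerrers (l ∷ Λ) → width Λ ≤ l
width-tail [-]      = z≤n
width-tail (l≥ ∷ _) = l≥

ferrers-tail : ∀ {l Λ} → IsFerrers (l ∷ Λ) → IsFerrers Λ
ferrers-tail [-]      = []
ferrers-tail (_ ∷ fs) = fs

term-drop : ∀ as i → term (drop 1 as) i ≡ term as (suc i)
term-drop []       i = refl
term-drop (_ ∷ as) i = refl

-- `Λ` is the part of the shape above its lowest `h` rows, and `r j` is the row of the one in column
-- `j`. Avoidance is required in each rectangle formed by the rows up to `h + i` and the columns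
-- that reach row `h + i`, because these are the maximal rectangles below and to the left of a cell.
record Placement (R : ℕ → ℕ → ℕ → Set) (h : ℕ) (Λ : Shape) (as : List ℕ) (r : ℕ → ℕ) : Set where
  field
    cells  : ∀ {j} → j < width Λ → h ≤ r j → j < term Λ (r j ∸ h)
    sums   : ∀ i → count (h + i) (reverseWord r (term Λ i)) ≡ term as i
    avoids : ∀ i → Excludes R (below (suc (h + i)) (reverseWord r (term Λ i)))

open Placement

module _ {R : ℕ → ℕ → ℕ → Set} where
  open BorderWords {Excludes R}

  fit-rows⁺ : ∀ h as → (∀ i → 0 ≡ term as i) → Fit h (map row as) []
  fit-rows⁺ h []       z = refl
  fit-rows⁺ h (a ∷ as) z = z 0 , tt , fit-rows⁺ (suc h) as (z ∘ suc)

  fit-rows⁻ : ∀ h as {xs} → Fit h (map row as) xs → xs ≡ [] × (∀ i → 0 ≡ term as i)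
  fit-rows⁻ h []       refl        = refl , λ _ → refl
  fit-rows⁻ h (a ∷ as) (e , _ , f) with refl , z ← fit-rows⁻ (suc h) as f = refl , λ { zero → e ; (suc i) → z i }

  fit-cols⁺ : ∀ h p r m d → (∀ {j} → m ≤ j → j < d + m → r j < h) → Fit h p (reverseWord r m) →
    Fit h (replicate d col ++ p) (reverseWord r (d + m))
  fit-cols⁺ h p r m zero    <h f = f
  fit-cols⁺ h p r m (suc d) <h f = <h (m≤n+m m d) (n<1+n (d + m)) , fit-cols⁺ h p r m d (λ m≤j j< → <h m≤j (m<n⇒m<1+n j<)) f

  fit-cols⁻ : ∀ h p r m d → Fit h (replicate d col ++ p) (reverseWord r (d + m)) →
    (∀ {j} → m ≤ j → j < d + m → r j < h) × Fit h p (reverseWord r m)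
  fit-cols⁻ h p r m zero    f        = (λ m≤j j<m → ⊥-elim (<⇒≱ j<m m≤j)) , f
  fit-cols⁻ h p r m (suc d) (c<h , f) with <h , f′ ← fit-cols⁻ h p r m d f = bound , f′
    where
    bound : ∀ {j} → m ≤ j → j < suc d + m → r j < h
    bound {j} m≤j j< with j ≟ d + m
    ... | yes refl = c<h
    ... | no j≢    = <h m≤j (≤∧≢⇒< (s≤s⁻¹ j<) j≢)

  placement-fit : ∀ {Λ} → IsFerrers Λ → ∀ h as r → Placement R h Λ as r → Fit h (border Λ as) (reverseWord r (width Λ))
  placement-fit {[]}    fs h as r P = fit-rows⁺ h as (sums P)
  placement-fit {l ∷ Λ} fs h as r P =
    subst (λ n → count n (reverseWord r l) ≡ term as 0) (+-identityʳ h) (sums P 0) ,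
    subst (λ n → Excludes R (below (suc n) (reverseWord r l))) (+-identityʳ h) (avoids P 0) ,
    subst (λ n → Fit (suc h) (replicate (l ∸ width Λ) col ++ border Λ (drop 1 as)) (reverseWord r n)) (m∸n+n≡m (width-tail fs))
      (fit-cols⁺ (suc h) _ r (width Λ) (l ∸ width Λ)
        -- A column that ends at row `h` has no cell higher up, so its one lies in row `h` or below.
        (λ w≤j j< → ≰⇒> λ h<rj → <⇒≱ (rest (subst (_ <_) (m∸n+n≡m (width-tail fs)) j<) h<rj)
                                     (≤-trans (term-width (ferrers-tail fs) _) w≤j))
        (placement-fit (ferrers-tail fs) (suc h) (drop 1 as) r record
          { cells  = λ j<w h<rj → rest (<-≤-trans j<w (width-tail fs)) h<rj
          ; sums   = λ i → trans (subst (λ n → count n (reverseWord r (term Λ i)) ≡ term as (suc i)) (+-suc h i) (sums P (suc i)))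
                                 (sym (term-drop as i))
          ; avoids = λ i → subst (λ n → Excludes R (below (suc n) (reverseWord r (term Λ i)))) (+-suc h i) (avoids P (suc i))
          }))
    where
    rest : ∀ {j} → j < l → suc h ≤ r j → j < term Λ (r j ∸ suc h)
    rest {j} j<l h<rj = subst (λ n → j < term (l ∷ Λ) n) (+-∸-assoc 1 h<rj) (cells P j<l (<⇒≤ h<rj))

  fit-placement : ∀ {Λ} → IsFerrers Λ → ∀ h as r → Fit h (border Λ as) (reverseWord r (width Λ)) → Placement R h Λ as r
  fit-placement {[]}    fs h as r f = record { cells = λ () ; sums = proj₂ (fit-rows⁻ h as f) ; avoids = λ _ → tt }
  fit-placement {l ∷ Λ} fs h as r (c , av , f)
    with <h , f′ ← fit-cols⁻ (suc h) _ r (width Λ) (l ∸ width Λ) (subst (λ n → Fit (suc h) (replicate (l ∸ width Λ) col ++ border Λ (drop 1 as)) (reverseWord r n)) (sym (m∸n+n≡m (width-tail fs))) f)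
    with P ← fit-placement (ferrers-tail fs) (suc h) (drop 1 as) r f′ = record
    { cells  = λ {j} j<l h≤rj → cell j<l h≤rj (h ≟ r j) (suc h ≤? r j)
    ; sums   = λ { zero    → subst (λ n → count n (reverseWord r l) ≡ term as 0) (sym (+-identityʳ h)) c
                 ; (suc i) → subst (λ n → count n (reverseWord r (term Λ i)) ≡ term as (suc i)) (sym (+-suc h i)) (trans (sums P i) (term-drop as i)) }
    ; avoids = λ { zero    → subst (λ n → Excludes R (below (suc n) (reverseWord r l))) (sym (+-identityʳ h)) av
                 ; (suc i) → subst (λ n → Excludes R (below (suc n) (reverseWord r (term Λ i)))) (sym (+-suc h i)) (avoids P i) }
    }
    where
    cell : ∀ {j} → j < l → h ≤ r j → Dec (h ≡ r j) → Dec (suc h ≤ r j) → j < term (l ∷ Λ) (r j ∸ h)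
    cell {j} j<l h≤rj (yes h≡rj) _ = subst (λ n → j < term (l ∷ Λ) n) (sym (trans (cong (_∸ h) (sym h≡rj)) (n∸n≡0 h))) j<l
    cell {j} j<l h≤rj (no h≢rj) (no h≮rj) = ⊥-elim (h≮rj (≤∧≢⇒< h≤rj h≢rj))
    cell {j} j<l h≤rj (no h≢rj) (yes h<rj) = subst (λ n → j < term (l ∷ Λ) n) (sym (+-∸-assoc 1 h<rj)) (cells P j<w h<rj)
      where
      j<w : j < width Λ
      j<w = ≰⇒> λ w≤j → <⇒≱ (<h w≤j (subst (j <_) (sym (m∸n+n≡m (width-tail fs))) j<l)) h<rj

  fit-length : ∀ {Λ} → IsFerrers Λ → ∀ h as {xs} → Fit h (border Λ as) xs → length xs ≡ width Λ
  fit-length {[]}    fs h as f with refl , _ ← fit-rows⁻ h as f = refl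
  fit-length {l ∷ Λ} fs h as (_ , _ , f) = trans (peel (l ∸ width Λ) f) (m∸n+n≡m (width-tail fs))
    where
    peel : ∀ d {xs} → Fit (suc h) (replicate d col ++ border Λ (drop 1 as)) xs → length xs ≡ d + width Λ
    peel zero    f = fit-length (ferrers-tail fs) (suc h) (drop 1 as) f
    peel (suc d) {_ ∷ _} (_ , f) = cong suc (peel d f)

-- Fillings as functions from columns to rows

unique-length : ∀ {A : Set} {xs ys : List A} → Unique xs → Unique ys →
  (∀ {x} → x ∈ xs → x ∈ ys) → (∀ {x} → x ∈ ys → x ∈ xs) → length xs ≡ length ys
unique-length xs! ys! xs⊆ys ys⊆xs = ↭-length (∼bag⇒↭ (unique∧set⇒bag xs! ys! (mk⇔ xs⊆ys ys⊆xs)))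

unique-map : ∀ {A B : Set} {f : A → B} {xs} → (∀ {x y} → x ∈ xs → y ∈ xs → f x ≡ f y → x ≡ y) →
  Unique xs → Unique (map f xs)
unique-map inj []         = []
unique-map inj (x≢ ∷ xs!) =
  All.map⁺ (All.tabulate (λ y∈ e → All.lookup x≢ y∈ (inj (here refl) (there y∈) e))) ∷
  unique-map (λ x∈ y∈ → inj (there x∈) (there y∈)) xs!

bit : ℕ → ℕ → Fin 2
bit a b = if does (a ≟ b) then 1F else 0F

bit-refl : ∀ a → bit a a ≡ 1F
bit-refl a rewrite dec-true (a ≟ a) refl = refl

bit-≢ : ∀ a b → a ≢ b → bit a b ≡ 0F
bit-≢ a b a≢b rewrite dec-false (a ≟ b) a≢b = refl

bit-1 : ∀ {a b} → bit a b ≡ 1F → a ≡ b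
bit-1 {a} {b} e with a ≟ b
... | yes a≡b = a≡b
... | no  a≢b with () ← trans (sym e) (bit-≢ a b a≢b)

bit-cong : ∀ a b c d → (a ≡ b → c ≡ d) → (c ≡ d → a ≡ b) → bit a b ≡ bit c d
bit-cong a b c d f g with a ≟ b
... | yes refl rewrite f refl = trans (bit-refl a) (sym (bit-refl d))
... | no  a≢b = trans (bit-≢ a b a≢b) (sym (bit-≢ c d (a≢b ∘ g)))

‼-bounded : ∀ {A : Set} {n} (v : Vec A n) j {b} → v ‼ j ≡ just b → j < n
‼-bounded (_ ∷ v) zero    e = z<s
‼-bounded (_ ∷ v) (suc j) e = s<s (‼-bounded v j e)

‼-defined : ∀ {A : Set} {n} (v : Vec A n) {j} → j < n → ∃ λ b → v ‼ j ≡ just b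
‼-defined (b ∷ v) {zero}  _   = b , refl
‼-defined (_ ∷ v) {suc j} j<n = ‼-defined v (s<s⁻¹ j<n)

‼-ext : ∀ {A : Set} {n} (v w : Vec A n) → (∀ {j} → j < n → v ‼ j ≡ w ‼ j) → v ≡ w
‼-ext []      []      e = refl
‼-ext (_ ∷ v) (_ ∷ w) e = cong₂ _∷_ (just-injective (e z<s)) (‼-ext v w (e ∘ s<s))

‼-tabulate : ∀ {A : Set} (g : ℕ → A) {n j} → j < n → tabulate {n = n} (g ∘ toℕ) ‼ j ≡ just (g j)
‼-tabulate g {suc n} {zero}  _   = refl
‼-tabulate g {suc n} {suc j} j<n = ‼-tabulate (g ∘ suc) (s<s⁻¹ j<n)

entry-cell : ∀ {Λ} (F : Filling Λ) i {j b} → entry F i j ≡ just b → j < term Λ i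
entry-cell (v ∷ F) zero    {j} e = ‼-bounded v j e
entry-cell (v ∷ F) (suc i) e = entry-cell F i e

entry-defined : ∀ {Λ} (F : Filling Λ) i {j} → j < term Λ i → ∃ λ b → entry F i j ≡ just b
entry-defined (v ∷ F) zero    j< = ‼-defined v j<
entry-defined (v ∷ F) (suc i) j< = entry-defined F i j<

filling-ext : ∀ {Λ} (F G : Filling Λ) → (∀ i {j} → j < term Λ i → entry F i j ≡ entry G i j) → F ≡ G
filling-ext []      []      e = refl
filling-ext (v ∷ F) (w ∷ G) e = cong₂ _∷_ (‼-ext v w (e 0)) (filling-ext F G (e ∘ suc))

term-height : ∀ Λ i {j} → j < term Λ i → i < height Λ
term-height Λ i j< = ≰⇒> λ h≤i → n≮0 (subst (_ <_) (term-outside Λ h≤i) j<)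

term-mono : ∀ {Λ} → IsFerrers Λ → ∀ {i i′} → i ≤ i′ → term Λ i′ ≤ term Λ i
term-mono {[]}    fs i≤i′ = z≤n
term-mono {l ∷ Λ} fs {zero}  {i′} i≤i′ = term-width fs i′
term-mono {l ∷ Λ} fs {suc i} {suc i′} i≤i′ = term-mono (ferrers-tail fs) (s≤s⁻¹ i≤i′)

fill : ∀ h Λ → (ℕ → ℕ) → Filling Λ
fill h []      r = []
fill h (l ∷ Λ) r = tabulate (λ j → bit (r (toℕ j)) h) ∷ fill (suc h) Λ r

entry-fill : ∀ h Λ r i {j} → j < term Λ i → entry (fill h Λ r) i j ≡ just (bit (r j) (h + i))
entry-fill h (l ∷ Λ) r zero    {j} j< = trans (‼-tabulate (λ j → bit (r j) h) j<) (cong (just ∘ bit (r j)) (sym (+-identityʳ h)))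
entry-fill h (l ∷ Λ) r (suc i) {j} j< = trans (entry-fill (suc h) Λ r i j<) (cong (just ∘ bit (r j)) (sym (+-suc h i)))

-- Only cells are constrained. This serves both directions: `r` extracted from a filling by `rowOf`,
-- and a filling built from `r` by `fill`.
record Reads {Λ} (F : Filling Λ) (r : ℕ → ℕ) : Set where
  field
    entry-bit : ∀ i {j} → j < term Λ i → entry F i j ≡ just (bit (r j) i)

open Reads

reads-injective : ∀ {Λ} → IsFerrers Λ → ∀ {F G : Filling Λ} {r s} → Reads F r → Reads G s →
  (∀ {j} → j < width Λ → r j ≡ s j) → F ≡ G
reads-injective fs {F} {G} F-r G-s r≡s = filling-ext F G λ i j< →
  trans (entry-bit F-r i j<) (trans (cong (λ a → just (bit a i)) (r≡s (<-≤-trans j< (term-width fs i)))) (sym (entry-bit G-s i j<)))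

module _ {Λ : Shape} (fs : IsFerrers Λ) {F : Filling Λ} {r : ℕ → ℕ} (reads : Reads F r) where

  entry-1⁻ : ∀ i {j} → entry F i j ≡ just 1F → j < term Λ i × r j ≡ i
  entry-1⁻ i e = j< , bit-1 (just-injective (trans (sym (entry-bit reads i j<)) e))
    where j< = entry-cell F i e

  entry-1⁺ : ∀ i {j} → j < term Λ i → r j ≡ i → entry F i j ≡ just 1F
  entry-1⁺ i {j} j< refl = trans (entry-bit reads i j<) (cong just (bit-refl (r j)))

  count-map : ∀ i js → count i (map r js) ≡ length (filter (λ j → r j ≟ i) js)
  count-map i []       = refl
  count-map i (j ∷ js) with r j ≟ i
  ... | yes rj≡i = trans (cong length (filter-accept (_≟ i) {xs = map r js} rj≡i))
                     (trans (cong suc (count-map i js)) (cong length (sym (filter-accept (λ j → r j ≟ i) {xs = js} rj≡i))))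
  ... | no  rj≢i = trans (cong length (filter-reject (_≟ i) {xs = map r js} rj≢i))
                     (trans (count-map i js) (cong length (sym (filter-reject (λ j → r j ≟ i) {xs = js} rj≢i))))

  onesInRow-count : ∀ i → onesInRow F i ≡ count i (reverseWord r (term Λ i))
  onesInRow-count i = trans
    (unique-length (Unique.filter⁺ (λ j → entry≟ F i j 1F) (Unique.upTo⁺ (width Λ)))
                   (Unique.filter⁺ (λ j → r j ≟ i) (Unique.downFrom⁺ (term Λ i)))
      (λ j∈ → let (_ , e) = ∈-filter⁻ (λ j → entry≟ F i j 1F) {xs = upTo (width Λ)} j∈ ; (j< , rj≡i) = entry-1⁻ i e in
        ∈-filter⁺ (λ j → r j ≟ i) (∈-downFrom⁺ j<) rj≡i)
      (λ j∈ → let (j∈ , rj≡i) = ∈-filter⁻ (λ j → r j ≟ i) {xs = downFrom (term Λ i)} j∈ ; j< = ∈-downFrom⁻ j∈ in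
        ∈-filter⁺ (λ j → entry≟ F i j 1F) (∈-upTo⁺ (<-≤-trans j< (term-width fs i))) (entry-1⁺ i j< rj≡i)))
    (sym (count-map i (downFrom (term Λ i))))

  onesInColumn-1 : ∀ {j} → j < term Λ (r j) → onesInColumn F j ≡ 1
  onesInColumn-1 {j} j< = unique-length (Unique.filter⁺ (λ i → entry≟ F i j 1F) (Unique.upTo⁺ (height Λ))) ([] ∷ [])
    (λ i∈ → here (sym (proj₂ (entry-1⁻ _ (proj₂ (∈-filter⁻ (λ i → entry≟ F i j 1F) {xs = upTo (height Λ)} i∈))))))
    (λ { (here refl) → ∈-filter⁺ (λ i → entry≟ F i j 1F) (∈-upTo⁺ (term-height Λ (r j) j<)) (entry-1⁺ (r j) j< refl) })

-- The default 0 is met only in a column without a one.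
headOr0 : List ℕ → ℕ
headOr0 []      = 0
headOr0 (i ∷ _) = i

rowOf : ∀ {Λ} → Filling Λ → ℕ → ℕ
rowOf {Λ} F j = headOr0 (filter (λ i → entry≟ F i j 1F) (upTo (height Λ)))

module _ {Λ : Shape} (F : Filling Λ) {j : ℕ} (one : onesInColumn F j ≡ 1) where

  private
    P? = λ i → entry≟ F i j 1F

    singleton : ∀ {is} → length is ≡ 1 → (headOr0 is ∈ is) × (∀ {i} → i ∈ is → i ≡ headOr0 is)
    singleton {i ∷ []} _ = here refl , λ { (here e) → e }

  rowOf-entry : entry F (rowOf F j) j ≡ just 1F
  rowOf-entry = proj₂ (∈-filter⁻ P? {xs = upTo (height Λ)} (proj₁ (singleton one)))

  rowOf-unique : ∀ {i} → entry F i j ≡ just 1F → i ≡ rowOf F j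
  rowOf-unique {i} e = proj₂ (singleton one) (∈-filter⁺ P? (∈-upTo⁺ (term-height Λ i (entry-cell F i e))) e)

ones-at : ∀ {Λ} {F : Filling Λ} → (∀ (j : Fin (width Λ)) → onesInColumn F (toℕ j) ≡ 1) → ∀ {j} → j < width Λ → onesInColumn F j ≡ 1
ones-at {F = F} ones j<w = subst (λ j → onesInColumn F j ≡ 1) (Fin.toℕ-fromℕ< j<w) (ones (fromℕ< j<w))

reads-rowOf : ∀ {Λ} → IsFerrers Λ → (F : Filling Λ) → (∀ (j : Fin (width Λ)) → onesInColumn F (toℕ j) ≡ 1) → Reads F (rowOf F)
reads-rowOf {Λ} fs F ones .entry-bit i {j} j< with entry-defined F i j<
... | 1F , e = trans e (cong just (sym (trans (cong (λ a → bit a i) (sym (rowOf-unique F one e))) (bit-refl i))))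
  where one = ones-at {F = F} ones (<-≤-trans j< (term-width fs i))
... | 0F , e = trans e (cong just (sym (bit-≢ (rowOf F j) i λ { refl → absurd (trans (sym e) (rowOf-entry F one)) })))
  where
  one = ones-at {F = F} ones (<-≤-trans j< (term-width fs i))
  absurd : ¬ _≡_ {A = Maybe (Fin 2)} (just 0F) (just 1F)
  absurd ()

-- Occurrences of a word in a filling

toFins : ∀ {m n} (v : Vec ℕ n) → (∀ l → lookup v l < m) → VecLinked _<_ v →
  ∃ λ (w : Vec (Fin m) n) → Increasing w × (∀ l → toℕ (lookup w l) ≡ lookup v l)
toFins []          <m _   = [] , [] , λ ()
toFins (a ∷ [])    <m [-] = fromℕ< (<m 0F) ∷ [] , [-] , λ { 0F → Fin.toℕ-fromℕ< (<m 0F) }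
toFins (a ∷ b ∷ v) <m (a<b ∷ v↑) with c ∷ w , w↑ , e ← toFins (b ∷ v) (<m ∘ Fin.suc) v↑ =
  fromℕ< (<m 0F) ∷ c ∷ w ,
  subst₂ _<_ (sym (Fin.toℕ-fromℕ< (<m 0F))) (sym (e 0F)) a<b ∷ w↑ ,
  λ { 0F → Fin.toℕ-fromℕ< (<m 0F) ; (Fin.suc l) → e l }

increasing-injective : ∀ {m n} {v : Vec (Fin m) n} → Increasing v → ∀ {k l} → toℕ (lookup v k) ≡ toℕ (lookup v l) → k ≡ l
increasing-injective v↑ {k} {l} e with Fin.<-cmp k l
... | tri< k<l _ _ = ⊥-elim (<⇒≢ (VecLinked.lookup⁺ Fin.<-trans v↑ k<l) e)
... | tri≈ _ k≡l _ = k≡l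
... | tri> _ _ l<k = ⊥-elim (<⇒≢ (VecLinked.lookup⁺ Fin.<-trans v↑ l<k) (sym e))

module Occurrences {Λ : Shape} (fs : IsFerrers Λ) {F : Filling Λ} {r : ℕ → ℕ} (reads : Reads F r)
  (x : Word) (σ : Fin (length (letters x)) → Fin (largest x))
  (letters-σ : ∀ j → List.lookup (letters x) j ≡ suc (toℕ (σ j))) where

  -- In a Ferrers shape the single cell in row `n` and column `k` guarantees all cells below and to
  -- the left of it. The zeros of the pattern matrix come for free, because each column reads just
  -- one row and the chosen rows are distinct.
  occurrence⁺ : ∀ n {k} → k < term Λ n → (ρ : Vec ℕ (largest x)) (c : Vec ℕ (length (letters x))) →
    VecLinked _<_ ρ → VecLinked _<_ c → (∀ l → lookup ρ l ≤ n) → (∀ j → lookup c j ≤ k) →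
    (∀ j → r (lookup c j) ≡ lookup ρ (σ j)) → Contains F x
  occurrence⁺ n {k} k< ρ c ρ↑ c↑ ρ≤n c≤k e
    with ρ′ , ρ′↑ , eρ ← toFins ρ (λ l → ≤-<-trans (ρ≤n l) (term-height Λ n k<)) ρ↑
    with c′ , c′↑ , ec ← toFins c (λ j → ≤-<-trans (c≤k j) (<-≤-trans k< (term-width fs n))) c↑ =
    ρ′ , c′ , ρ′↑ , c′↑ , λ l j → trans
      (entry-bit reads (toℕ (lookup ρ′ l)) (≤-<-trans (≤-trans (≤-reflexive (ec j)) (c≤k j))
        (<-≤-trans k< (term-mono fs (≤-trans (≤-reflexive (eρ l)) (ρ≤n l))))))
      (cong just (bit-cong (r (toℕ (lookup c′ j))) (toℕ (lookup ρ′ l)) (List.lookup (letters x) j) (suc (toℕ l))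
        (λ rc≡ρl → trans (letters-σ j) (cong (suc ∘ toℕ) (increasing-injective ρ′↑ (trans (sym (rows ρ′ c′ ec eρ j)) rc≡ρl))))
        (λ j≡l → trans (rows ρ′ c′ ec eρ j) (cong (toℕ ∘ lookup ρ′) (Fin.toℕ-injective (suc-injective (trans (sym (letters-σ j)) j≡l)))))))
    where
    rows : ∀ {m m′} (ρ′ : Vec (Fin m) _) (c′ : Vec (Fin m′) _) → (∀ j → toℕ (lookup c′ j) ≡ lookup c j) → (∀ l → toℕ (lookup ρ′ l) ≡ lookup ρ l) →
      ∀ j → r (toℕ (lookup c′ j)) ≡ toℕ (lookup ρ′ (σ j))
    rows ρ′ c′ ec eρ j = trans (cong r (ec j)) (trans (e j) (sym (eρ (σ j))))

  module _ {ρ : Vec (Fin (height Λ)) (largest x)} {c : Vec (Fin (width Λ)) (length (letters x))} (occ : IsOccurrence F x ρ c) where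

    occurrence-cell : ∀ l j → toℕ (lookup c j) < term Λ (toℕ (lookup ρ l))
    occurrence-cell l j = entry-cell F (toℕ (lookup ρ l)) (proj₂ (proj₂ occ) l j)

    occurrence-row : ∀ j → r (toℕ (lookup c j)) ≡ toℕ (lookup ρ (σ j))
    occurrence-row j = proj₂ (entry-1⁻ fs reads (toℕ (lookup ρ (σ j))) (trans (proj₂ (proj₂ occ) (σ j) j)
      (cong just (trans (cong (λ a → bit a (suc (toℕ (σ j)))) (letters-σ j)) (bit-refl (suc (toℕ (σ j))))))))

-- Counting fillings by runs

reverseWord-cong : ∀ {r s : ℕ → ℕ} n → (∀ {j} → j < n → r j ≡ s j) → reverseWord r n ≡ reverseWord s n
reverseWord-cong zero    r≡s = refl
reverseWord-cong (suc n) r≡s = cong₂ _∷_ (r≡s (n<1+n n)) (reverseWord-cong n (λ j<n → r≡s (m<n⇒m<1+n j<n)))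

reverseWord-injective : ∀ {r s : ℕ → ℕ} n → reverseWord r n ≡ reverseWord s n → ∀ {j} → j < n → r j ≡ s j
reverseWord-injective (suc n) e {j} j<1+n with j ≟ n
... | yes refl = ∷-injectiveˡ e
... | no  j≢n  = reverseWord-injective n (∷-injectiveʳ e) (≤∧≢⇒< (s≤s⁻¹ j<1+n) j≢n)

-- Inverse to `reverseWord`: the head is the last column, so positions are counted from the end of
-- the list. The default 0 lies outside the word.
letterAt : List ℕ → ℕ → ℕ
letterAt []       j = 0
letterAt (x ∷ xs) j with j ≟ length xs
... | yes _ = x
... | no  _ = letterAt xs j

letterAt-word : ∀ xs → reverseWord (letterAt xs) (length xs) ≡ xs
letterAt-word []       = refl
letterAt-word (x ∷ xs) = cong₂ _∷_ first (trans (reverseWord-cong (length xs) rest) (letterAt-word xs))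
  where
  first : letterAt (x ∷ xs) (length xs) ≡ x
  first with length xs ≟ length xs
  ... | yes _ = refl
  ... | no  ≢ = ⊥-elim (≢ refl)
  rest : ∀ {j} → j < length xs → letterAt (x ∷ xs) j ≡ letterAt xs j
  rest {j} j< with j ≟ length xs
  ... | yes refl = ⊥-elim (n≮n _ j<)
  ... | no  _    = refl

record Describes (Ω : List Word) (R : ℕ → ℕ → ℕ → Set) : Set where
  field
    excludes⇒avoids : ∀ {Λ} → IsFerrers Λ → ∀ {F : Filling Λ} {r} → Reads F r →
      (∀ i → Excludes R (below (suc i) (reverseWord r (term Λ i)))) → All (Avoids F) Ω
    avoids⇒excludes : ∀ {Λ} → IsFerrers Λ → ∀ {F : Filling Λ} {r} → Reads F r →
      All (Avoids F) Ω → ∀ i → Excludes R (below (suc i) (reverseWord r (term Λ i)))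

module Count {Ω : List Word} {R : ℕ → ℕ → ℕ → Set} (D : Describes Ω R) (M : Model (Excludes R)) where
  open Describes D
  open Model M
  open WordRuns M

  module _ {Λ : Shape} (fs : IsFerrers Λ) (as : List ℕ) where

    placement : ∀ {F} → W Λ as Ω F → Placement R 0 Λ as (rowOf F)
    placement {F} (ones , sums , avoids) = record
      { cells  = λ j<w _ → entry-cell F _ (rowOf-entry F (ones-at {F = F} ones j<w))
      ; sums   = λ i → trans (sym (onesInRow-count fs reads i)) (sums i)
      ; avoids = avoids⇒excludes fs reads avoids
      }
      where reads = reads-rowOf fs F ones

    filling : ∀ {r} → Placement R 0 Λ as r → W Λ as Ω (fill 0 Λ r)
    filling {r} P =
      (λ j → onesInColumn-1 fs reads (Placement.cells P (Fin.toℕ<n j) z≤n)) ,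
      (λ i → trans (onesInRow-count fs reads i) (Placement.sums P i)) ,
      excludes⇒avoids fs reads (Placement.avoids P)
      where
      reads : Reads (fill 0 Λ r) r
      reads .entry-bit = entry-fill 0 Λ r

    wordOf : Filling Λ → List ℕ
    wordOf F = reverseWord (rowOf F) (width Λ)

    wordOf-fill : ∀ {r} → Placement R 0 Λ as r → ∀ {j} → j < width Λ → rowOf (fill 0 Λ r) j ≡ r j
    wordOf-fill {r} P {j} j<w = sym (rowOf-unique (fill 0 Λ r) (onesInColumn-1 fs reads cell) (entry-1⁺ fs reads (r j) cell refl))
      where
      reads : Reads (fill 0 Λ r) r
      reads .entry-bit = entry-fill 0 Λ r
      cell = Placement.cells P j<w z≤n

    fillings : List (Filling Λ)
    fillings = filter (W? Λ as Ω) (allFillings Λ)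

    ∈-fillings⁻ : ∀ {F} → F ∈ fillings → W Λ as Ω F
    ∈-fillings⁻ F∈ = proj₂ (∈-filter⁻ (W? Λ as Ω) {xs = allFillings Λ} F∈)

    wordOf-injective : ∀ {F G} → F ∈ fillings → G ∈ fillings → wordOf F ≡ wordOf G → F ≡ G
    wordOf-injective {F} {G} F∈ G∈ e =
      reads-injective fs (reads-rowOf fs F (proj₁ (∈-fillings⁻ F∈))) (reads-rowOf fs G (proj₁ (∈-fillings⁻ G∈)))
        (reverseWord-injective (width Λ) e)

    wordOf-run : ∀ {F} → F ∈ fillings → wordOf F ∈ wordRuns 0 (border Λ as) start
    wordOf-run {F} F∈ = wordRuns-complete 0 (border Λ as) valid-start
      (trans (filter-none (_<? 0) (All.universal (λ _ ()) (wordOf F))) (sym toWord-start))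
      (placement-fit fs 0 as (rowOf F) (placement {F} (∈-fillings⁻ F∈)))

    run-wordOf : ∀ {xs} → xs ∈ wordRuns 0 (border Λ as) start → xs ∈ map wordOf fillings
    run-wordOf {xs} xs∈ with _ , f ← wordRuns-sound 0 (border Λ as) valid-start xs∈ =
      subst (_∈ map wordOf fillings) (trans (reverseWord-cong (width Λ) (wordOf-fill P)) eq)
        (∈-map⁺ wordOf (∈-filter⁺ (W? Λ as Ω) (∈-allFillings (fill 0 Λ (letterAt xs))) (filling P)))
      where
      eq : reverseWord (letterAt xs) (width Λ) ≡ xs
      eq = subst (λ n → reverseWord (letterAt xs) n ≡ xs) (fit-length fs 0 as f) (letterAt-word xs)
      P : Placement R 0 Λ as (letterAt xs)
      P = fit-placement fs 0 as (letterAt xs) (subst (Fit 0 (border Λ as)) (sym eq) f)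

    -- A filling is determined by the rows of its ones, and the words so obtained are exactly the
    -- recorded ones. Both lists are free of repetitions, so their lengths agree.
    ∣W∣-runs : ∣W∣ Λ as Ω ≡ length (wordRuns 0 (border Λ as) start)
    ∣W∣-runs = trans (sym (length-map wordOf fillings)) (unique-length
      (unique-map wordOf-injective (Unique.filter⁺ (W? Λ as Ω) (allFillings-unique Λ)))
      (wordRuns-unique 0 (border Λ as) valid-start)
      (λ xs∈ → let (F , F∈ , e) = ∈-map⁻ wordOf xs∈ in subst (_∈ wordRuns 0 (border Λ as) start) (sym e) (wordOf-run F∈))
      run-wordOf)

-- The two pairs of patterns

violation : ∀ {Λ R r} → (∀ i → Excludes R (below (suc i) (reverseWord r (term Λ i)))) →
  ∀ n {i j k a b c} → i < j → j < k → k < term Λ n → r i ≡ a → r j ≡ b → r k ≡ c → a ≤ n → b ≤ n → c ≤ n → ¬ R a b c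
violation {Λ} ex n i<j j<k k< refl refl refl a≤n b≤n c≤n = excludes⁻ (term Λ n) (ex n) i<j j<k k< (s≤s a≤n) (s≤s b≤n) (s≤s c≤n)

describes231 : Describes (word (2 ∷ 3 ∷ 1 ∷ []) ∷ word (2 ∷ 2 ∷ 1 ∷ []) ∷ []) Pattern231
describes231 = record
  { excludes⇒avoids = λ {Λ} fs reads ex →
      (λ { (p ∷ q ∷ s ∷ [] , i ∷ j ∷ k ∷ [] , occ@((p<q ∷ q<s ∷ [-]) , (i<j ∷ j<k ∷ [-]) , _)) →
        violation {Λ} ex (toℕ s) i<j j<k (O231.occurrence-cell fs reads occ 2F 2F)
          (O231.occurrence-row fs reads occ 0F) (O231.occurrence-row fs reads occ 1F) (O231.occurrence-row fs reads occ 2F)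
          (<⇒≤ q<s) ≤-refl (<⇒≤ (<-trans p<q q<s)) (p<q , <⇒≤ q<s) }) ∷
      (λ { (p ∷ q ∷ [] , i ∷ j ∷ k ∷ [] , occ@((p<q ∷ [-]) , (i<j ∷ j<k ∷ [-]) , _)) →
        violation {Λ} ex (toℕ q) i<j j<k (O221.occurrence-cell fs reads occ 1F 2F)
          (O221.occurrence-row fs reads occ 0F) (O221.occurrence-row fs reads occ 1F) (O221.occurrence-row fs reads occ 2F)
          ≤-refl ≤-refl (<⇒≤ p<q) (p<q , ≤-refl) }) ∷ []
  ; avoids⇒excludes = λ {Λ} fs reads → λ { (av231 ∷ av221 ∷ []) n → excludes⁺ (term Λ n)
      -- The weak inequality splits: `a < b` gives an occurrence of 231, `a ≡ b` one of 221. The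
      -- cell in row `n` and column `k` bounds both.
      λ {i} {j} {k} i<j j<k k< a< b< c< (c<a , a≤b) → case (m≤n⇒m<n∨m≡n a≤b) of λ
        { (inj₁ a<b) → av231 (O231.occurrence⁺ fs reads n k<
            (_ ∷ _ ∷ _ ∷ []) (i ∷ j ∷ k ∷ []) (c<a ∷ a<b ∷ [-]) (i<j ∷ j<k ∷ [-])
            (λ { 0F → s≤s⁻¹ c< ; 1F → s≤s⁻¹ a< ; 2F → s≤s⁻¹ b< })
            (λ { 0F → <⇒≤ (<-trans i<j j<k) ; 1F → <⇒≤ j<k ; 2F → ≤-refl })
            (λ { 0F → refl ; 1F → refl ; 2F → refl }))
        ; (inj₂ a≡b) → av221 (O221.occurrence⁺ fs reads n k<
            (_ ∷ _ ∷ []) (i ∷ j ∷ k ∷ []) (c<a ∷ [-]) (i<j ∷ j<k ∷ [-])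
            (λ { 0F → s≤s⁻¹ c< ; 1F → s≤s⁻¹ a< })
            (λ { 0F → <⇒≤ (<-trans i<j j<k) ; 1F → <⇒≤ j<k ; 2F → ≤-refl })
            (λ { 0F → refl ; 1F → sym a≡b ; 2F → refl })) } }
  }
  where
  σ231 : Fin 3 → Fin 3
  σ231 = λ { 0F → 1F ; 1F → 2F ; 2F → 0F }
  eq231 : ∀ j → List.lookup (2 ∷ 3 ∷ 1 ∷ []) j ≡ suc (toℕ (σ231 j))
  eq231 = λ { 0F → refl ; 1F → refl ; 2F → refl }
  module O231 {Λ : Shape} (fs : IsFerrers Λ) {F : Filling Λ} {r : ℕ → ℕ} (reads : Reads F r) =
    Occurrences fs reads (word (2 ∷ 3 ∷ 1 ∷ [])) σ231 eq231
  σ221 : Fin 3 → Fin 2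
  σ221 = λ { 0F → 1F ; 1F → 1F ; 2F → 0F }
  eq221 : ∀ j → List.lookup (2 ∷ 2 ∷ 1 ∷ []) j ≡ suc (toℕ (σ221 j))
  eq221 = λ { 0F → refl ; 1F → refl ; 2F → refl }
  module O221 {Λ : Shape} (fs : IsFerrers Λ) {F : Filling Λ} {r : ℕ → ℕ} (reads : Reads F r) =
    Occurrences fs reads (word (2 ∷ 2 ∷ 1 ∷ [])) σ221 eq221

describes312 : Describes (word (3 ∷ 1 ∷ 2 ∷ []) ∷ word (2 ∷ 1 ∷ 2 ∷ []) ∷ []) Pattern312
describes312 = record
  { excludes⇒avoids = λ {Λ} fs reads ex →
      (λ { (p ∷ q ∷ s ∷ [] , i ∷ j ∷ k ∷ [] , occ@((p<q ∷ q<s ∷ [-]) , (i<j ∷ j<k ∷ [-]) , _)) →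
        violation {Λ} ex (toℕ s) i<j j<k (O312.occurrence-cell fs reads occ 2F 2F)
          (O312.occurrence-row fs reads occ 0F) (O312.occurrence-row fs reads occ 1F) (O312.occurrence-row fs reads occ 2F)
          ≤-refl (<⇒≤ (<-trans p<q q<s)) (<⇒≤ q<s) (p<q , <⇒≤ q<s) }) ∷
      (λ { (p ∷ q ∷ [] , i ∷ j ∷ k ∷ [] , occ@((p<q ∷ [-]) , (i<j ∷ j<k ∷ [-]) , _)) →
        violation {Λ} ex (toℕ q) i<j j<k (O212.occurrence-cell fs reads occ 1F 2F)
          (O212.occurrence-row fs reads occ 0F) (O212.occurrence-row fs reads occ 1F) (O212.occurrence-row fs reads occ 2F)
          ≤-refl (<⇒≤ p<q) ≤-refl (p<q , ≤-refl) }) ∷ []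
  ; avoids⇒excludes = λ {Λ} fs reads → λ { (av312 ∷ av212 ∷ []) n → excludes⁺ (term Λ n)
      -- Likewise `c < a` gives 312 and `c ≡ a` gives 212.
      λ {i} {j} {k} i<j j<k k< a< b< c< (b<c , c≤a) → case (m≤n⇒m<n∨m≡n c≤a) of λ
        { (inj₁ c<a) → av312 (O312.occurrence⁺ fs reads n k<
            (_ ∷ _ ∷ _ ∷ []) (i ∷ j ∷ k ∷ []) (b<c ∷ c<a ∷ [-]) (i<j ∷ j<k ∷ [-])
            (λ { 0F → s≤s⁻¹ b< ; 1F → s≤s⁻¹ c< ; 2F → s≤s⁻¹ a< })
            (λ { 0F → <⇒≤ (<-trans i<j j<k) ; 1F → <⇒≤ j<k ; 2F → ≤-refl })
            (λ { 0F → refl ; 1F → refl ; 2F → refl }))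
        ; (inj₂ c≡a) → av212 (O212.occurrence⁺ fs reads n k<
            (_ ∷ _ ∷ []) (i ∷ j ∷ k ∷ []) (b<c ∷ [-]) (i<j ∷ j<k ∷ [-])
            (λ { 0F → s≤s⁻¹ b< ; 1F → s≤s⁻¹ c< })
            (λ { 0F → <⇒≤ (<-trans i<j j<k) ; 1F → <⇒≤ j<k ; 2F → ≤-refl })
            (λ { 0F → sym c≡a ; 1F → refl ; 2F → refl })) } }
  }
  where
  σ312 : Fin 3 → Fin 3
  σ312 = λ { 0F → 2F ; 1F → 0F ; 2F → 1F }
  eq312 : ∀ j → List.lookup (3 ∷ 1 ∷ 2 ∷ []) j ≡ suc (toℕ (σ312 j))
  eq312 = λ { 0F → refl ; 1F → refl ; 2F → refl }
  module O312 {Λ : Shape} (fs : IsFerrers Λ) {F : Filling Λ} {r : ℕ → ℕ} (reads : Reads F r) =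
    Occurrences fs reads (word (3 ∷ 1 ∷ 2 ∷ [])) σ312 eq312
  σ212 : Fin 3 → Fin 2
  σ212 = λ { 0F → 1F ; 1F → 0F ; 2F → 1F }
  eq212 : ∀ j → List.lookup (2 ∷ 1 ∷ 2 ∷ []) j ≡ suc (toℕ (σ212 j))
  eq212 = λ { 0F → refl ; 1F → refl ; 2F → refl }
  module O212 {Λ : Shape} (fs : IsFerrers Λ) {F : Filling Λ} {r : ℕ → ℕ} (reads : Reads F r) =
    Occurrences fs reads (word (2 ∷ 1 ∷ 2 ∷ [])) σ212 eq212

theorem14 :
  ShapeWilfEquivalent
    (word (2 ∷ 3 ∷ 1 ∷ []) ∷ word (2 ∷ 2 ∷ 1 ∷ []) ∷ [])
    (word (3 ∷ 1 ∷ 2 ∷ []) ∷ word (2 ∷ 1 ∷ 2 ∷ []) ∷ [])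
theorem14 Λ as fs _ = begin
  _ ≡⟨ Count.∣W∣-runs describes231 Model231.model fs as ⟩
  _ ≡⟨ Model231.length-wordRuns (border Λ as) ⟩
  _ ≡⟨ Model312.length-wordRuns (border Λ as) ⟨
  _ ≡⟨ Count.∣W∣-runs describes312 Model312.model fs as ⟨
  _ ∎
  where open ≡-Reasoning
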